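{- There is an absolute constant $C>0$ such that for all integers $n,w\ge 1$, every $\varepsilon>0$, and every $f:\{0,1\}^n\to\{0,1\}$ computed by a DNF formula of width $w$, there is a $k$-junta $g:\{0,1\}^n\to\{0,1\}$ with $k\le (w\log(1/\varepsilon))^{Cw}$ that $\varepsilon$-approximates $f$.
   Context: A DNF formula is an OR of terms, each term being an AND of literals; it has width $w$ if every term contains at most $w$ literals (the number of terms is arbitrary). A $k$-junta is a function that depends on at most $k$ of its variables. The function $g$ $\varepsilon$-approximates $f$ if $\Pr_x[f(x)\neq g(x)]\le\varepsilon$ for $x$ uniform in $\{0,1\}^n$. Convention: in the bound on $k$, $\log(y)$ is read as $\max\{2,\log_2 y\}$. -}

module Defs where

open import Data.Bool using (Bool; true; false; not; _≟_)
open import Data.Fin using (Fin)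
open import Data.Fin.Subset using (Subset; _∈_; ∣_∣)
open import Data.Integer using (ℤ; +_; -[1+_])
open import Data.List using (List; []; _∷_; _++_; map; all; any; length; filter)
open import Data.List.Relation.Unary.All using (All)
open import Data.Nat as ℕ using (ℕ; zero; suc)
open import Data.Nat.Properties using (m^n≢0)
open import Data.Product using (∃-syntax; _×_)
open import Data.Rational using (ℚ; _/_; _*_; _<_; _≤_; 0ℚ; 1ℚ; ½; ↥_; ↧ₙ_; +-*-rawSemiring)
open import Data.Sum using (_⊎_)
open import Data.Vec using (Vec; []; _∷_; lookup)
open import Level using (0ℓ)
open import Relation.Binary.PropositionalEquality using (_≡_)
open import Relation.Nullary using (¬_; ¬?)
open import Relation.Unary using (Pred; Decidable)

open import Algebra.Definitions.RawSemiring +-*-rawSemiring public using (_^_)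

fromℕ : ℕ → ℚ
fromℕ n = + n / 1

record ℝ : Set₁ where
  field
    lower upper   : Pred ℚ 0ℓ
    lower-inhab   : ∃[ q ] lower q
    upper-inhab   : ∃[ q ] upper q
    lower-closed  : ∀ {q r} → q < r → lower r → lower q
    upper-closed  : ∀ {q r} → q < r → upper q → upper r
    lower-rounded : ∀ {q} → lower q → ∃[ r ] (q < r × lower r)
    upper-rounded : ∀ {r} → upper r → ∃[ q ] (q < r × upper q)
    disjoint      : ∀ {q} → ¬ (lower q × upper q)
    located       : ∀ {q r} → q < r → lower q ⊎ upper r

infix 4 _<ʳ_ _≤ʳ_

_<ʳ_ : ℚ → ℝ → Set
q <ʳ x = ℝ.lower x q

_≤ʳ_ : ℚ → ℝ → Set
q ≤ʳ x = ¬ ℝ.upper x q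

2^_ : ℤ → ℚ
2^ (+ n)    = fromℕ 2 ^ n
2^ -[1+ n ] = ½ ^ suc n

-- For ε > 0 and q = a / b in lowest terms, log₂ (1 / ε) < q means 2^(-a/b) < ε,
-- i.e. some positive rational r < ε has 1 ≤ 2^a · r^b.

log₂[1/_]<_ : ℝ → ℚ → Set
log₂[1/ ε ]< q = ∃[ r ] (r <ʳ ε × 0ℚ < r × 1ℚ ≤ (2^ (↥ q)) * r ^ (↧ₙ q))

-- The convention log y = max {2, log₂ y}.

log[1/_]<_ : ℝ → ℚ → Set
log[1/ ε ]< q = fromℕ 2 < q × log₂[1/ ε ]< q

-- k ≤ (w · log (1 / ε)) ^ m.  The real number log (1 / ε) is given by the
-- rationals q above it; as t ↦ (w · t) ^ m is continuous and nondecreasing for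
-- t ≥ 0, the bound holds at log (1 / ε) exactly when it holds at every such q.

_≤[_·log1/_]^_ : ℕ → ℕ → ℝ → ℕ → Set
k ≤[ w ·log1/ ε ]^ m = ∀ q → log[1/ ε ]< q → fromℕ k ≤ (fromℕ w * q) ^ m

Point : ℕ → Set
Point n = Vec Bool n

BoolFun : ℕ → Set
BoolFun n = Point n → Bool

data Literal (n : ℕ) : Set where
  pos neg : Fin n → Literal n

Term : ℕ → Set
Term n = List (Literal n)

DNF : ℕ → Set
DNF n = List (Term n)

evalLiteral : ∀ {n} → Literal n → BoolFun n
evalLiteral (pos i) x = lookup x i
evalLiteral (neg i) x = not (lookup x i)

evalTerm : ∀ {n} → Term n → BoolFun n
evalTerm t x = all (λ l → evalLiteral l x) t

evalDNF : ∀ {n} → DNF n → BoolFun n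
evalDNF φ x = any (λ t → evalTerm t x) φ

HasWidth : ∀ {n} → ℕ → DNF n → Set
HasWidth w φ = All (λ t → length t ℕ.≤ w) φ

Computes : ∀ {n} → DNF n → BoolFun n → Set
Computes φ f = ∀ x → evalDNF φ x ≡ f x

DependsOnlyOn : ∀ {n} → BoolFun n → Subset n → Set
DependsOnlyOn g S = ∀ x y → (∀ i → i ∈ S → lookup x i ≡ lookup y i) → g x ≡ g y

IsJunta : ∀ {n} → ℕ → BoolFun n → Set
IsJunta k g = ∃[ S ] (∣ S ∣ ℕ.≤ k × DependsOnlyOn g S)

cube : ∀ n → List (Point n)
cube zero    = [] ∷ []
cube (suc n) = map (false ∷_) (cube n) ++ map (true ∷_) (cube n)

Pr : ∀ {n} {P : Pred (Point n) 0ℓ} → Decidable P → ℚ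
Pr {n} P? = _/_ (+ length (filter P? (cube n))) (2 ℕ.^ n) {{m^n≢0 2 n}}

Approximates : ∀ {n} → ℝ → BoolFun n → BoolFun n → Set
Approximates ε g f = Pr (λ x → ¬? (f x ≟ g x)) ≤ʳ ε

{-# OPTIONS --safe #-}

-- Call a partial assignment Y with s fixed coordinates an implicant if f equals 1
-- up to probability 2^-(d s) once Y is imposed, for a suitable increasing
-- sequence d, and let g be the disjunction of the minimal implicants of size at
-- most w.  Every term of the formula is an implicant, so f ≤ g, and a union bound
-- controls the points with f = 0 and g = 1.  The number of minimal implicants of
-- size s is at most r^s, where r is polynomial in w log (1/ε): among more than
-- r^s of them choose Z maximising r^|Z| times the number of those extending Z.
-- What these fix beyond Z is then an r-spread family, so with overwhelming
-- probability some member of it is satisfied, which makes Z a smaller implicant.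
--
-- The exponentially small failure probability of a spread family is obtained
-- without Janson's inequality, which does not apply to terms with negations: colour
-- the variables at random with ℓ colours.  By Chebyshev's inequality, each colour
-- class separately contains a satisfied member except with probability 1/(2ℓ),
-- so for some colouring each class fails with probability at most 1/2; distinct
-- classes are independent.

module Submission where

open import Algebra.Bundles using (CommutativeRing)
open import Data.Bool using (Bool; true; false; if_then_else_; not; _∧_)
import Data.Bool as Bool
open import Data.Bool.ListAction using (all; any)
open import Data.Empty using (⊥)
open import Data.Fin using (Fin; zero; suc)
import Data.Fin as Fin
import Data.Fin.Subset as Subset
import Data.Fin.Subset.Properties as Subsetₚ
import Data.Integer as ℤ
import Data.Integer.Properties as ℤₚ
open import Data.List using (List; []; _∷_; _++_; map; concatMap; length; filter; take; cartesianProductWith; cartesianProduct; downFrom)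
open import Data.List.Extrema.Nat using (argmax; f[xs]≤f[argmax])
open import Data.List.Membership.Propositional using (_∈_; find; lose)
open import Data.List.Membership.Propositional.Properties
open import Data.List.Properties using (length-map; length-++; length-downFrom; length-take; ++-identityʳ)
open import Data.List.Relation.Unary.All as All using (All; []; _∷_)
import Data.List.Relation.Unary.All.Properties as Allₚ
open import Data.List.Relation.Unary.Any as Any using (here; there)
open import Data.List.Relation.Unary.Unique.Propositional using (Unique; []; _∷_)
import Data.List.Relation.Unary.Unique.Propositional.Properties as Uniqueₚ
open import Data.Maybe using (Maybe; just; nothing; is-just)
import Data.Maybe.Properties as Maybeₚ
open import Data.Nat
open import Data.Nat.Coprimality using (1-coprimeTo) renaming (sym to coprime-sym)
open import Data.Nat.Properties
open import Data.Nat.Tactic.RingSolver using (solve-∀)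
open import Data.Product using (∃-syntax; _×_; _,_; proj₁; proj₂)
open import Data.Rational using (ℚ; mkℚ; *≤*; *<*; 0ℚ; 1ℚ; ½; toℚᵘ; nonNegative; positive; ↥_; ↧ₙ_)
  renaming (_+_ to _+ℚ_; _*_ to _*ℚ_; _≤_ to _≤ℚ_; _<_ to _<ℚ_; _/_ to _/ℚ_)
import Data.Rational.Properties as ℚₚ
open import Data.Rational.Unnormalised using (mkℚᵘ; *≡*)
import Data.Rational.Unnormalised as ℚᵘ
import Data.Rational.Unnormalised.Properties as ℚᵘₚ
open import Data.Sum using (_⊎_; inj₁; inj₂)
open import Data.Vec using (Vec; []; _∷_; zipWith; zip)
import Data.Vec as Vec
import Data.Vec.Properties as Vecₚ
open import Data.Vec.Relation.Binary.Pointwise.Inductive as Pointwise using (Pointwise; []; _∷_)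
open import Defs renaming (_^_ to _^ℚ_)
open import Function using (_∘_; case_of_)
open import Relation.Binary.Definitions using (tri<; tri≈; tri>)
open import Relation.Binary.PropositionalEquality
open import Relation.Nullary
open import Relation.Nullary.Decidable using (dec-true; dec-false; decidable-stable; does-≡)

open import Algebra.Properties.Semiring.Exp (CommutativeRing.semiring ℚₚ.+-*-commutativeRing)
  using () renaming (^-assocʳ to ^ℚ-assocʳ; ^-homo-* to ^ℚ-homo-*)

private variable
  A B D : Set
  n : ℕ

-- Finite sums

∑ : List A → (A → ℕ) → ℕ
∑ []       f = 0
∑ (x ∷ xs) f = f x + ∑ xs f

infix 5 ∑
syntax ∑ xs (λ x → e) = ∑[ x ∈ xs ] e

∑-cong : ∀ (xs : List A) {f g} → (∀ x → f x ≡ g x) → ∑ xs f ≡ ∑ xs g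
∑-cong []       eq = refl
∑-cong (x ∷ xs) eq = cong₂ _+_ (eq x) (∑-cong xs eq)

∑-cong-All : ∀ {xs : List A} {f g} → All (λ x → f x ≡ g x) xs → ∑ xs f ≡ ∑ xs g
∑-cong-All []       = refl
∑-cong-All (p ∷ ps) = cong₂ _+_ p (∑-cong-All ps)

∑-mono-All : ∀ {xs : List A} {f g} → All (λ x → f x ≤ g x) xs → ∑ xs f ≤ ∑ xs g
∑-mono-All []       = z≤n
∑-mono-All (p ∷ ps) = +-mono-≤ p (∑-mono-All ps)

∑-mono : ∀ (xs : List A) {f g} → (∀ x → f x ≤ g x) → ∑ xs f ≤ ∑ xs g
∑-mono xs le = ∑-mono-All (All.universal le xs)

∑-distrib-+ : ∀ (xs : List A) f g → ∑ xs (λ x → f x + g x) ≡ ∑ xs f + ∑ xs g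
∑-distrib-+ []       f g = refl
∑-distrib-+ (x ∷ xs) f g = trans (cong (f x + g x +_) (∑-distrib-+ xs f g)) (lem (f x) (g x) _ _)
  where
  lem : ∀ a b c d → a + b + (c + d) ≡ a + c + (b + d)
  lem = solve-∀

*-∑ : ∀ c (xs : List A) f → c * ∑ xs f ≡ ∑ xs (λ x → c * f x)
*-∑ c []       f = *-zeroʳ c
*-∑ c (x ∷ xs) f = trans (*-distribˡ-+ c (f x) _) (cong (c * f x +_) (*-∑ c xs f))

∑-* : ∀ c (xs : List A) f → ∑ xs f * c ≡ ∑ xs (λ x → f x * c)
∑-* c xs f = trans (*-comm _ c) (trans (*-∑ c xs f) (∑-cong xs λ x → *-comm c (f x)))

∑-const : ∀ (xs : List A) c → ∑ xs (λ _ → c) ≡ length xs * c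
∑-const []       c = refl
∑-const (x ∷ xs) c = cong (c +_) (∑-const xs c)

∑-zero : ∀ (xs : List A) → ∑ xs (λ _ → 0) ≡ 0
∑-zero xs = trans (∑-const xs 0) (*-zeroʳ (length xs))

∑-swap : ∀ (xs : List A) (ys : List B) (f : A → B → ℕ) → ∑ xs (λ x → ∑ ys (f x)) ≡ ∑ ys (λ y → ∑ xs (λ x → f x y))
∑-swap []       ys f = sym (∑-zero ys)
∑-swap (x ∷ xs) ys f = trans (cong (∑ ys (f x) +_) (∑-swap xs ys f)) (sym (∑-distrib-+ ys (f x) _))

∑-++ : ∀ (xs ys : List A) f → ∑ (xs ++ ys) f ≡ ∑ xs f + ∑ ys f
∑-++ []       ys f = refl
∑-++ (x ∷ xs) ys f = trans (cong (f x +_) (∑-++ xs ys f)) (sym (+-assoc (f x) _ _))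

∑-map : ∀ (g : A → B) xs f → ∑ (map g xs) f ≡ ∑ xs (f ∘ g)
∑-map g []       f = refl
∑-map g (x ∷ xs) f = cong (f (g x) +_) (∑-map g xs f)

∑-cartesianProductWith : ∀ (h : A → B → D) xs ys f →
  ∑ (cartesianProductWith h xs ys) f ≡ ∑ xs (λ x → ∑ ys (λ y → f (h x y)))
∑-cartesianProductWith h []       ys f = refl
∑-cartesianProductWith h (x ∷ xs) ys f = trans (∑-++ (map (h x) ys) _ f)
  (cong₂ _+_ (∑-map (h x) ys f) (∑-cartesianProductWith h xs ys f))

∑-product : ∀ (xs : List A) (ys : List B) f g → ∑ xs (λ x → ∑ ys (λ y → f x * g y)) ≡ ∑ xs f * ∑ ys g
∑-product xs ys f g = trans (∑-cong xs λ x → sym (*-∑ (f x) ys g)) (sym (∑-* (∑ ys g) xs f))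

∑-∈ : ∀ {xs : List A} {x} f → x ∈ xs → f x ≤ ∑ xs f
∑-∈ f (here refl) = m≤m+n _ _
∑-∈ f (there p)   = ≤-trans (∑-∈ f p) (m≤n+m _ _)

𝟙 : ∀ {P : Set} → Dec P → ℕ
𝟙 P? = if does P? then 1 else 0

𝟙-yes : ∀ {P : Set} (P? : Dec P) → P → 𝟙 P? ≡ 1
𝟙-yes P? p rewrite dec-true P? p = refl

𝟙-no : ∀ {P : Set} (P? : Dec P) → ¬ P → 𝟙 P? ≡ 0
𝟙-no P? ¬p rewrite dec-false P? ¬p = refl

𝟙-mono : ∀ {P Q : Set} (P? : Dec P) (Q? : Dec Q) → (P → Q) → 𝟙 P? ≤ 𝟙 Q?
𝟙-mono (yes p) Q? imp = ≤-reflexive (sym (𝟙-yes Q? (imp p)))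
𝟙-mono (no _)  Q? imp = z≤n

𝟙-≤ : ∀ {P : Set} (P? : Dec P) {m} → (P → 1 ≤ m) → 𝟙 P? ≤ m
𝟙-≤ (yes p) le = le p
𝟙-≤ (no _)  le = z≤n

∑-filter : ∀ {P : A → Set} (P? : ∀ x → Dec (P x)) xs f → ∑ (filter P? xs) f ≡ ∑ xs (λ x → 𝟙 (P? x) * f x)
∑-filter P? []       f = refl
∑-filter P? (x ∷ xs) f with P? x
... | yes _ = cong₂ _+_ (sym (*-identityˡ (f x))) (∑-filter P? xs f)
... | no  _ = ∑-filter P? xs f

length≡∑ : ∀ (xs : List A) → length xs ≡ ∑ xs (λ _ → 1)
length≡∑ xs = sym (trans (∑-const xs 1) (*-identityʳ _))

length-filter≡∑ : ∀ {P : A → Set} (P? : ∀ x → Dec (P x)) xs → length (filter P? xs) ≡ ∑ xs (λ x → 𝟙 (P? x))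
length-filter≡∑ P? xs = trans (length≡∑ (filter P? xs))
  (trans (∑-filter P? xs _) (∑-cong xs λ x → *-identityʳ _))

-- Averaging: a bound that holds on average over a nonempty list holds at some entry. This is how a
-- good colouring is extracted from a random one.
∑-≤⇒∃ : ∀ (xs : List A) {f g} → 0 < length xs → ∑ xs f ≤ ∑ xs g → ∃[ x ] f x ≤ g x
∑-≤⇒∃ (x ∷ xs) {f} {g} _ le with f x ≤? g x
... | yes p = x , p
∑-≤⇒∃ (x ∷ []) {f} {g} _ le | no p = contradiction (≤-trans (m≤m+n _ _) (≤-trans le (≤-reflexive (+-identityʳ _)))) p
∑-≤⇒∃ (x ∷ xs@(_ ∷ _)) {f} {g} _ le | no p = ∑-≤⇒∃ xs z<s
  (+-cancelˡ-≤ (f x) _ _ (≤-trans le (+-monoˡ-≤ _ (≰⇒≥ p))))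

-- The uniform product space as an explicit list, so that probabilities become counts. Points,
-- colourings, coloured points and patterns all arise from it by the choice of alphabet.
words : List A → ∀ n → List (Vec A n)
words L zero    = [] ∷ []
words L (suc n) = cartesianProductWith _∷_ L (words L n)

length-words : ∀ (L : List A) n → length (words L n) ≡ length L ^ n
length-words L zero    = refl
length-words L (suc n) = begin
  length (words L (suc n))                  ≡⟨ length≡∑ (words L (suc n)) ⟩
  ∑ (words L (suc n)) (λ _ → 1)             ≡⟨ ∑-cartesianProductWith _∷_ L (words L n) _ ⟩
  ∑ L (λ _ → ∑ (words L n) λ _ → 1)         ≡⟨ ∑-const L _ ⟩
  length L * ∑ (words L n) (λ _ → 1)        ≡⟨ cong (length L *_) (length≡∑ (words L n)) ⟨
  length L * length (words L n)             ≡⟨ cong (length L *_) (length-words L n) ⟩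
  length L * length L ^ n                   ∎
  where open ≡-Reasoning

∑-words : ∀ (L : List A) n f → ∑ (words L (suc n)) f ≡ ∑ L (λ a → ∑ (words L n) (λ z → f (a ∷ z)))
∑-words L n f = ∑-cartesianProductWith _∷_ L (words L n) f

-- Patterns

-- A pattern fixes the coordinates at which it is `just`: it plays the role of a
-- consistent term, `size` being its width.

Pattern : ℕ → Set
Pattern n = Vec (Maybe Bool) n

size₁ : Maybe Bool → ℕ
size₁ nothing  = 0
size₁ (just _) = 1

size : Pattern n → ℕ
size []      = 0
size (p ∷ Y) = size₁ p + size Y

data _≼_ : Maybe Bool → Maybe Bool → Set where
  free  : ∀ {p} → nothing ≼ p
  same : ∀ {b} → just b ≼ just b

_≼?_ : ∀ p p′ → Dec (p ≼ p′)
nothing    ≼? _          = yes free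
just _     ≼? nothing    = no λ ()
just false ≼? just false = yes same
just false ≼? just true  = no λ ()
just true  ≼? just false = no λ ()
just true  ≼? just true  = yes same

≼-trans : ∀ {p q r} → p ≼ q → q ≼ r → p ≼ r
≼-trans free  _    = free
≼-trans same same = same

infix 4 _⊑_ _⊑?_

_⊑_ : Pattern n → Pattern n → Set
_⊑_ = Pointwise _≼_

_⊑?_ : ∀ (Y Z : Pattern n) → Dec (Y ⊑ Z)
_⊑?_ = Pointwise.decidable _≼?_

⊑-trans : {X Y Z : Pattern n} → X ⊑ Y → Y ⊑ Z → X ⊑ Z
⊑-trans = Pointwise.trans ≼-trans

⊑-refl : {Y : Pattern n} → Y ⊑ Y
⊑-refl = Pointwise.refl (λ { {nothing} → free ; {just _} → same })

𝟙-∷ : ∀ p p′ (Y Z : Pattern n) → 𝟙 ((p ∷ Y) ⊑? (p′ ∷ Z)) ≡ 𝟙 (p ≼? p′) * 𝟙 (Y ⊑? Z)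
𝟙-∷ p p′ Y Z with does (p ≼? p′)
... | false = refl
... | true  = sym (+-identityʳ _)

size-mono : {Y Z : Pattern n} → Y ⊑ Z → size Y ≤ size Z
size-mono []         = z≤n
size-mono (free  ∷ q) = ≤-trans (size-mono q) (m≤n+m _ _)
size-mono (same ∷ q) = s≤s (size-mono q)

⊑-size⇒≡ : {Y Z : Pattern n} → Y ⊑ Z → size Z ≤ size Y → Y ≡ Z
⊑-size⇒≡ [] _ = refl
⊑-size⇒≡ (free {nothing} ∷ q) le = cong (nothing ∷_) (⊑-size⇒≡ q le)
⊑-size⇒≡ (free {just _} ∷ q) le = contradiction (≤-trans le (size-mono q)) (<⇒≱ ≤-refl)
⊑-size⇒≡ (same ∷ q) (s≤s le) = cong (_ ∷_) (⊑-size⇒≡ q le)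

subs₁ : Maybe Bool → List (Maybe Bool)
subs₁ nothing  = nothing ∷ []
subs₁ (just b) = nothing ∷ just b ∷ []

subs : Pattern n → List (Pattern n)
subs []      = [] ∷ []
subs (p ∷ Y) = cartesianProductWith _∷_ (subs₁ p) (subs Y)

∈-subs₁⁺ : ∀ {p p′} → p ≼ p′ → p ∈ subs₁ p′
∈-subs₁⁺ {p′ = nothing} free  = here refl
∈-subs₁⁺ {p′ = just _}  free  = here refl
∈-subs₁⁺                same = there (here refl)

∈-subs₁⁻ : ∀ {p} p′ → p ∈ subs₁ p′ → p ≼ p′
∈-subs₁⁻ nothing  (here refl)         = free
∈-subs₁⁻ (just _) (here refl)         = free
∈-subs₁⁻ (just _) (there (here refl)) = same

∈-subs⁺ : {Z Y : Pattern n} → Z ⊑ Y → Z ∈ subs Y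
∈-subs⁺ []       = here refl
∈-subs⁺ (p ∷ ps) = ∈-cartesianProductWith⁺ _∷_ (∈-subs₁⁺ p) (∈-subs⁺ ps)

∈-subs⁻ : {Z : Pattern n} (Y : Pattern n) → Z ∈ subs Y → Z ⊑ Y
∈-subs⁻ []      (here refl) = []
∈-subs⁻ (p ∷ Y) i with ∈-cartesianProductWith⁻ _∷_ (subs₁ p) (subs Y) i
... | _ , _ , i₁ , i₂ , refl = ∈-subs₁⁻ p i₁ ∷ ∈-subs⁻ Y i₂

_∖₁_ : Maybe Bool → Maybe Bool → Maybe Bool
p ∖₁ nothing = p
p ∖₁ just _  = nothing

_∖_ : Pattern n → Pattern n → Pattern n
_∖_ = zipWith _∖₁_

-- Left-biased, but applied below only to patterns that fix disjoint sets of coordinates, where it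
-- is the plain union.
_∪₁_ : Maybe Bool → Maybe Bool → Maybe Bool
nothing ∪₁ p = p
just b  ∪₁ _ = just b

_∪_ : Pattern n → Pattern n → Pattern n
_∪_ = zipWith _∪₁_

size-∖ : {Y Z : Pattern n} → Z ⊑ Y → size Z + size (Y ∖ Z) ≡ size Y
size-∖ []                     = refl
size-∖ {Y = p ∷ Y} {Z = nothing ∷ Z} (free ∷ q) = trans (lem (size Z) (size₁ p) (size (Y ∖ Z))) (cong (size₁ p +_) (size-∖ q))
  where
  lem : ∀ a b c → a + (b + c) ≡ b + (a + c)
  lem = solve-∀
size-∖ (same ∷ q)             = cong suc (size-∖ q)

size-∪ : {U Y : Pattern n} (Z : Pattern n) → U ⊑ Y ∖ Z → size (U ∪ Z) ≡ size U + size Z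
size-∪ {U = []} [] q = refl
size-∪ {U = nothing ∷ U} {_ ∷ Y} (p ∷ Z) (_ ∷ q) = trans (cong (size₁ p +_) (size-∪ Z q)) (lem (size₁ p) (size U) (size Z))
  where
  lem : ∀ a b c → a + (b + c) ≡ b + (a + c)
  lem = solve-∀
size-∪ {U = just b ∷ U} {_ ∷ Y} (nothing ∷ Z) (_ ∷ q) = cong suc (size-∪ Z q)
size-∪ {U = just b ∷ U} {_ ∷ Y} (just _ ∷ Z) (() ∷ q)

∪-⊑ : {U Y Z : Pattern n} → U ⊑ Y ∖ Z → Z ⊑ Y → U ∪ Z ⊑ Y
∪-⊑ [] [] = []
∪-⊑ {U = nothing ∷ _} (_ ∷ q) (r ∷ rs) = r ∷ ∪-⊑ q rs
∪-⊑ {U = just _ ∷ _} {Z = nothing ∷ _} (p ∷ q) (r ∷ rs) = p ∷ ∪-⊑ q rs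
∪-⊑ {U = just _ ∷ _} {Z = just _ ∷ _} (() ∷ q) (r ∷ rs)

-- The binomial theorem, one coordinate at a time: a fixed coordinate of `Y` either stays in `V` and
-- contributes `q`, or is left out and contributes `r`.
∑-subs : ∀ q r (Y : Pattern n) → ∑[ V ∈ subs Y ] q ^ size V * r ^ size (Y ∖ V) ≡ (q + r) ^ size Y
∑-subs q r []      = refl
∑-subs q r (p ∷ Y) = begin
  ∑ (subs (p ∷ Y)) (λ V → q ^ size V * r ^ size ((p ∷ Y) ∖ V))
    ≡⟨ ∑-cartesianProductWith _∷_ (subs₁ p) (subs Y) _ ⟩
  (∑[ v ∈ subs₁ p ] ∑[ V ∈ subs Y ] q ^ (size₁ v + size V) * r ^ (size₁ (p ∖₁ v) + size (Y ∖ V)))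
    ≡⟨ ∑-cong (subs₁ p) (λ v → ∑-cong (subs Y) λ V → split v V) ⟩
  (∑[ v ∈ subs₁ p ] ∑[ V ∈ subs Y ] (q ^ size₁ v * r ^ size₁ (p ∖₁ v)) * (q ^ size V * r ^ size (Y ∖ V)))
    ≡⟨ ∑-product (subs₁ p) (subs Y) _ _ ⟩
  (∑[ v ∈ subs₁ p ] q ^ size₁ v * r ^ size₁ (p ∖₁ v)) * (∑[ V ∈ subs Y ] q ^ size V * r ^ size (Y ∖ V))
    ≡⟨ cong₂ _*_ (letter p) (∑-subs q r Y) ⟩
  (q + r) ^ size₁ p * (q + r) ^ size Y
    ≡⟨ ^-distribˡ-+-* (q + r) (size₁ p) (size Y) ⟨
  (q + r) ^ (size₁ p + size Y) ∎
  where
  open ≡-Reasoning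
  lem : ∀ a b c d → (a * b) * (c * d) ≡ (a * c) * (b * d)
  lem = solve-∀
  split : ∀ v V → q ^ (size₁ v + size V) * r ^ (size₁ (p ∖₁ v) + size (Y ∖ V)) ≡
          (q ^ size₁ v * r ^ size₁ (p ∖₁ v)) * (q ^ size V * r ^ size (Y ∖ V))
  split v V = trans (cong₂ _*_ (^-distribˡ-+-* q (size₁ v) _) (^-distribˡ-+-* r (size₁ (p ∖₁ v)) _))
    (lem (q ^ size₁ v) _ _ _)
  letter : ∀ p → (∑[ v ∈ subs₁ p ] q ^ size₁ v * r ^ size₁ (p ∖₁ v)) ≡ (q + r) ^ size₁ p
  letter nothing  = refl
  letter (just _) = lem₂ q r
    where
    lem₂ : ∀ q r → (r * 1 + 0) + (q * 1 * 1 + 0) ≡ (q + r) * 1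
    lem₂ = solve-∀

-- Spread families

2ab≤a²+b² : ∀ a b → 2 * (a * b) ≤ a * a + b * b
2ab≤a²+b² a b with ≤-total a b
... | inj₁ a≤b rewrite sym (m+[n∸m]≡n a≤b) =
  ≤-trans (m≤m+n _ ((b ∸ a) * (b ∸ a))) (≤-reflexive (lem a (b ∸ a)))
  where
  lem : ∀ a c → 2 * (a * (a + c)) + c * c ≡ a * a + (a + c) * (a + c)
  lem = solve-∀
... | inj₂ b≤a rewrite sym (m+[n∸m]≡n b≤a) =
  ≤-trans (m≤m+n _ ((a ∸ b) * (a ∸ b))) (≤-reflexive (lem b (a ∸ b)))
  where
  lem : ∀ b c → 2 * ((b + c) * b) + c * c ≡ (b + c) * (b + c) + b * b
  lem = solve-∀

*-interchange : ∀ a b c d → (a * b) * (c * d) ≡ (a * c) * (b * d)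
*-interchange = solve-∀

hits : List (Pattern n) → Pattern n → ℕ
hits F v = ∑[ Y ∈ F ] 𝟙 (Y ⊑? v)

degree : List (Pattern n) → Pattern n → ℕ
degree F V = ∑[ Y ∈ F ] 𝟙 (V ⊑? Y)

-- Probabilistically: a uniform member of `F` extends `V` with probability at most r^-|V|. Only
-- sub-patterns of members are tested, since every other `V` has degree 0.
Spread : ℕ → List (Pattern n) → Set
Spread r F = All (λ Y → ∀ V → V ⊑ Y → r ^ size V * degree F V ≤ length F) F

-- A uniform letter reveals a bit of its coordinate or nothing. Exactly one of the q letters reveals
-- a given bit, so a pattern of size s is revealed by a uniform word with probability q^-s.
module SecondMoment (L : List A) (view : A → Maybe Bool)
  (view-unique : ∀ b → ∑[ a ∈ L ] 𝟙 (just b ≼? view a) ≡ 1) where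

  private
    q = length L

  viewed : Vec A n → Pattern n
  viewed = Vec.map view

  ∑-≼-view : ∀ p → (∑[ a ∈ L ] 𝟙 (p ≼? view a)) * q ^ size₁ p ≡ q
  ∑-≼-view nothing  = trans (*-identityʳ _) (sym (length≡∑ L))
  ∑-≼-view (just b) = trans (cong₂ _*_ (view-unique b) (*-identityʳ q)) (*-identityˡ q)

  ∑-⊑-viewed : ∀ (Y : Pattern n) → (∑[ z ∈ words L n ] 𝟙 (Y ⊑? viewed z)) * q ^ size Y ≡ q ^ n
  ∑-⊑-viewed []              = refl
  ∑-⊑-viewed {suc n} (p ∷ Y) = begin
    (∑[ z ∈ words L (suc n) ] 𝟙 ((p ∷ Y) ⊑? viewed z)) * q ^ (size₁ p + size Y)
      ≡⟨ cong₂ _*_ split (^-distribˡ-+-* q (size₁ p) (size Y)) ⟩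
    ((∑[ a ∈ L ] 𝟙 (p ≼? view a)) * (∑[ z ∈ words L n ] 𝟙 (Y ⊑? viewed z))) * (q ^ size₁ p * q ^ size Y)
      ≡⟨ *-interchange (∑ L _) _ _ _ ⟩
    ((∑[ a ∈ L ] 𝟙 (p ≼? view a)) * q ^ size₁ p) * ((∑[ z ∈ words L n ] 𝟙 (Y ⊑? viewed z)) * q ^ size Y)
      ≡⟨ cong₂ _*_ (∑-≼-view p) (∑-⊑-viewed Y) ⟩
    q * q ^ n ∎
    where
    open ≡-Reasoning
    split : (∑[ z ∈ words L (suc n) ] 𝟙 ((p ∷ Y) ⊑? viewed z)) ≡
            (∑[ a ∈ L ] 𝟙 (p ≼? view a)) * (∑[ z ∈ words L n ] 𝟙 (Y ⊑? viewed z))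
    split = trans (∑-words L n _)
      (trans (∑-cong L λ a → ∑-cong (words L n) λ z → 𝟙-∷ p (view a) Y (viewed z))
             (∑-product L (words L n) _ _))

  -- The correlation at one coordinate: opposite bits are never revealed together, equal bits are
  -- revealed together q times as often as under independence, and otherwise the two events are
  -- independent.
  ∑-≼-≼-view : ∀ p p′ →
    (∑[ a ∈ L ] 𝟙 (p ≼? view a) * 𝟙 (p′ ≼? view a)) * (q ^ size₁ p * q ^ size₁ p′) ≤
    q * (∑[ v ∈ subs₁ p ] 𝟙 (v ≼? p′) * q ^ size₁ v)
  ∑-≼-≼-view nothing p′ = ≤-reflexive (begin
    (∑[ a ∈ L ] 1 * 𝟙 (p′ ≼? view a)) * (1 * q ^ size₁ p′)
      ≡⟨ cong₂ _*_ (∑-cong L λ a → *-identityˡ _) (*-identityˡ _) ⟩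
    (∑[ a ∈ L ] 𝟙 (p′ ≼? view a)) * q ^ size₁ p′
      ≡⟨ ∑-≼-view p′ ⟩
    q
      ≡⟨ *-identityʳ q ⟨
    q * 1 ∎)
    where open ≡-Reasoning
  ∑-≼-≼-view (just b) nothing = begin
    (∑[ a ∈ L ] 𝟙 (just b ≼? view a) * 1) * (q ^ 1 * 1)
      ≡⟨ cong₂ _*_ (∑-cong L λ a → *-identityʳ _) (*-identityʳ _) ⟩
    (∑[ a ∈ L ] 𝟙 (just b ≼? view a)) * q ^ 1
      ≡⟨ ∑-≼-view (just b) ⟩
    q
      ≡⟨ *-identityʳ q ⟨
    q * 1
      ≤⟨ *-monoʳ-≤ q (m≤m+n 1 _) ⟩
    q * (1 + ((𝟙 (just b ≼? nothing) * q ^ 1) + 0)) ∎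
    where open ≤-Reasoning
  ∑-≼-≼-view (just b) (just b′) with b Bool.≟ b′
  ... | yes refl rewrite 𝟙-yes (just b ≼? just b) same = begin
    (∑[ a ∈ L ] 𝟙 (just b ≼? view a) * 𝟙 (just b ≼? view a)) * (q ^ 1 * q ^ 1)
      ≤⟨ *-monoˡ-≤ _ (∑-mono L λ a → 𝟙-* (just b ≼? view a) (just b ≼? view a)) ⟩
    (∑[ a ∈ L ] 𝟙 (just b ≼? view a)) * (q ^ 1 * q ^ 1)
      ≡⟨ cong (_* (q ^ 1 * q ^ 1)) (view-unique b) ⟩
    1 * (q * 1 * (q * 1))
      ≡⟨ lem q ⟩
    q * (1 * (q * 1) + 0)
      ≤⟨ *-monoʳ-≤ q (m≤n+m _ 1) ⟩
    q * (1 + (1 * (q * 1) + 0)) ∎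
    where
    open ≤-Reasoning
    𝟙-* : ∀ {P Q : Set} (P? : Dec P) (Q? : Dec Q) → 𝟙 P? * 𝟙 Q? ≤ 𝟙 P?
    𝟙-* (yes _) Q? = ≤-trans (≤-reflexive (+-identityʳ _)) (𝟙-≤ Q? λ _ → ≤-refl)
    𝟙-* (no _)  Q? = z≤n
    lem : ∀ q → 1 * (q * 1 * (q * 1)) ≡ q * (1 * (q * 1) + 0)
    lem = solve-∀
  ... | no b≢b′ = ≤-trans (≤-reflexive (cong (_* (q ^ 1 * q ^ 1)) (trans (∑-cong L λ a → conflict (view a)) (∑-zero L)))) z≤n
    where
    clash : ∀ {p} → just b ≼ p → just b′ ≼ p → b ≡ b′
    clash same same = refl
    conflict : ∀ p → 𝟙 (just b ≼? p) * 𝟙 (just b′ ≼? p) ≡ 0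
    conflict p with just b ≼? p | just b′ ≼? p
    ... | yes s | yes s′ = contradiction (clash s s′) b≢b′
    ... | yes _ | no _   = refl
    ... | no _  | _      = refl

  -- Product of the one-coordinate bounds. Bounding the correlation by a sum over all common
  -- sub-patterns `V`, instead of by the largest one, lets the later sum over `Y′` be expressed
  -- through degrees. Conflicting literals only lower the left side.
  ∑-⊑-⊑-viewed : ∀ (Y Y′ : Pattern n) →
    (∑[ z ∈ words L n ] 𝟙 (Y ⊑? viewed z) * 𝟙 (Y′ ⊑? viewed z)) * (q ^ size Y * q ^ size Y′) ≤
    q ^ n * (∑[ V ∈ subs Y ] 𝟙 (V ⊑? Y′) * q ^ size V)
  ∑-⊑-⊑-viewed []              []        = ≤-refl
  ∑-⊑-⊑-viewed {suc n} (p ∷ Y) (p′ ∷ Y′) = begin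
    (∑[ z ∈ words L (suc n) ] 𝟙 ((p ∷ Y) ⊑? viewed z) * 𝟙 ((p′ ∷ Y′) ⊑? viewed z)) *
      (q ^ (size₁ p + size Y) * q ^ (size₁ p′ + size Y′))
      ≡⟨ cong₂ _*_ splitˡ (trans (cong₂ _*_ (^-distribˡ-+-* q (size₁ p) _) (^-distribˡ-+-* q (size₁ p′) _))
                                (*-interchange (q ^ size₁ p) _ _ _)) ⟩
    ((∑[ a ∈ L ] 𝟙 (p ≼? view a) * 𝟙 (p′ ≼? view a)) *
      (∑[ z ∈ words L n ] 𝟙 (Y ⊑? viewed z) * 𝟙 (Y′ ⊑? viewed z))) *
      ((q ^ size₁ p * q ^ size₁ p′) * (q ^ size Y * q ^ size Y′))
      ≡⟨ *-interchange (∑ L _) _ _ _ ⟩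
    ((∑[ a ∈ L ] 𝟙 (p ≼? view a) * 𝟙 (p′ ≼? view a)) * (q ^ size₁ p * q ^ size₁ p′)) *
      ((∑[ z ∈ words L n ] 𝟙 (Y ⊑? viewed z) * 𝟙 (Y′ ⊑? viewed z)) * (q ^ size Y * q ^ size Y′))
      ≤⟨ *-mono-≤ (∑-≼-≼-view p p′) (∑-⊑-⊑-viewed Y Y′) ⟩
    (q * (∑[ v ∈ subs₁ p ] 𝟙 (v ≼? p′) * q ^ size₁ v)) * (q ^ n * (∑[ V ∈ subs Y ] 𝟙 (V ⊑? Y′) * q ^ size V))
      ≡⟨ *-interchange q _ _ _ ⟩
    (q * q ^ n) * ((∑[ v ∈ subs₁ p ] 𝟙 (v ≼? p′) * q ^ size₁ v) * (∑[ V ∈ subs Y ] 𝟙 (V ⊑? Y′) * q ^ size V))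
      ≡⟨ cong (q * q ^ n *_) splitʳ ⟨
    q ^ suc n * (∑[ V ∈ subs (p ∷ Y) ] 𝟙 (V ⊑? (p′ ∷ Y′)) * q ^ size V) ∎
    where
    open ≤-Reasoning
    splitˡ : (∑[ z ∈ words L (suc n) ] 𝟙 ((p ∷ Y) ⊑? viewed z) * 𝟙 ((p′ ∷ Y′) ⊑? viewed z)) ≡
      (∑[ a ∈ L ] 𝟙 (p ≼? view a) * 𝟙 (p′ ≼? view a)) *
      (∑[ z ∈ words L n ] 𝟙 (Y ⊑? viewed z) * 𝟙 (Y′ ⊑? viewed z))
    splitˡ = trans (∑-words L n _) (trans
      (∑-cong L λ a → ∑-cong (words L n) λ z → trans
        (cong₂ _*_ (𝟙-∷ p (view a) Y (viewed z)) (𝟙-∷ p′ (view a) Y′ (viewed z)))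
        (*-interchange (𝟙 (p ≼? view a)) _ _ _))
      (∑-product L (words L n) _ _))
    splitʳ : (∑[ V ∈ subs (p ∷ Y) ] 𝟙 (V ⊑? (p′ ∷ Y′)) * q ^ size V) ≡
      (∑[ v ∈ subs₁ p ] 𝟙 (v ≼? p′) * q ^ size₁ v) * (∑[ V ∈ subs Y ] 𝟙 (V ⊑? Y′) * q ^ size V)
    splitʳ = trans (∑-cartesianProductWith _∷_ (subs₁ p) (subs Y) _) (trans
      (∑-cong (subs₁ p) λ v → ∑-cong (subs Y) λ V → trans
        (cong₂ _*_ (𝟙-∷ v p′ V Y′) (^-distribˡ-+-* q (size₁ v) (size V)))
        (*-interchange (𝟙 (v ≼? p′)) _ _ _))
      (∑-product (subs₁ p) (subs Y) _ _))

  -- Chebyshev's inequality for the number of members of F hit by a random word.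
  ∑-unhit : ∀ (F : List (Pattern n)) t r →
    0 < length F → All (λ Y → size Y ≡ t) F →
    Spread r F →
    ((∑[ z ∈ words L n ] 𝟙 (hits F (viewed z) ≟ 0)) + q ^ n) * r ^ t ≤ q ^ n * (q + r) ^ t
  ∑-unhit {n} F t r 0<N sizes spread = *-cancelˡ-≤ (N * N) {{>-nonZero (*-mono-< 0<N 0<N)}} (begin
    N * N * ((U + q ^ n) * r ^ t)
      ≡⟨ *-assoc (N * N) (U + q ^ n) (r ^ t) ⟨
    N * N * (U + q ^ n) * r ^ t
      ≤⟨ *-monoˡ-≤ (r ^ t) (+-cancelʳ-≤ (N * N * q ^ n) _ _ deviation) ⟩
    (∑[ z ∈ W ] (X z * Q) * (X z * Q)) * r ^ t
      ≡⟨ ∑-square ⟩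
    ∑[ Y ∈ F ] (∑[ Y′ ∈ F ] pairs Y Y′ * (Q * Q)) * r ^ t
      ≤⟨ ∑-mono-All (All.zipWith (λ { (eq , sp) → row _ eq sp }) (sizes , spread)) ⟩
    ∑[ Y ∈ F ] q ^ n * (N * (q + r) ^ t)
      ≡⟨ ∑-const F _ ⟩
    N * (q ^ n * (N * (q + r) ^ t))
      ≡⟨ lem₁ N (q ^ n) ((q + r) ^ t) ⟩
    N * N * (q ^ n * (q + r) ^ t) ∎)
    where
    open ≤-Reasoning
    N = length F
    W = words L n
    Q = q ^ t
    X : Vec A n → ℕ
    X z = hits F (viewed z)
    U = ∑[ z ∈ W ] 𝟙 (X z ≟ 0)
    pairs : Pattern n → Pattern n → ℕ
    pairs Y Y′ = ∑[ z ∈ W ] 𝟙 (Y ⊑? viewed z) * 𝟙 (Y′ ⊑? viewed z)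

    lem₁ : ∀ a b c → a * (b * (a * c)) ≡ a * a * (b * c)
    lem₁ = solve-∀

    -- The inequality (xQ - N)^2 ≥ N^2 [x = 0] with the square expanded and the subtraction moved
    -- across. Here `N` is the mean of `X z * Q`, by `∑-mean`.
    pointwise : ∀ x → N * N * 𝟙 (x ≟ 0) + 2 * N * (x * Q) ≤ (x * Q) * (x * Q) + N * N
    pointwise zero = ≤-reflexive (lem N)
      where
      lem : ∀ N → N * N * 1 + 2 * N * 0 ≡ N * N
      lem = solve-∀
    pointwise x@(suc _) = ≤-trans (≤-reflexive (lem N (x * Q))) (2ab≤a²+b² (x * Q) N)
      where
      lem : ∀ N y → N * N * 0 + 2 * N * y ≡ 2 * (y * N)
      lem = solve-∀

    ∑-mean : (∑[ z ∈ W ] X z * Q) ≡ N * q ^ n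
    ∑-mean = begin-equality
      (∑[ z ∈ W ] X z * Q)                              ≡⟨ ∑-* Q W X ⟨
      (∑[ z ∈ W ] X z) * Q                              ≡⟨ cong (_* Q) (∑-swap W F _) ⟩
      (∑[ Y ∈ F ] ∑[ z ∈ W ] 𝟙 (Y ⊑? viewed z)) * Q     ≡⟨ ∑-* Q F _ ⟩
      (∑[ Y ∈ F ] (∑[ z ∈ W ] 𝟙 (Y ⊑? viewed z)) * Q)   ≡⟨ ∑-cong-All (All.map (λ {Y} eq →
                                                             trans (cong (λ s → (∑[ z ∈ W ] 𝟙 (Y ⊑? viewed z)) * q ^ s) (sym eq)) (∑-⊑-viewed Y)) sizes) ⟩
      (∑[ Y ∈ F ] q ^ n)                                ≡⟨ ∑-const F _ ⟩
      N * q ^ n                                         ∎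

    deviation : N * N * (U + q ^ n) + N * N * q ^ n ≤ (∑[ z ∈ W ] (X z * Q) * (X z * Q)) + N * N * q ^ n
    deviation = begin
      N * N * (U + q ^ n) + N * N * q ^ n
        ≡⟨ lem N U (q ^ n) ⟩
      N * N * U + 2 * N * (N * q ^ n)
        ≡⟨ cong₂ _+_ (*-∑ (N * N) W _) (trans (cong (2 * N *_) (sym ∑-mean)) (*-∑ (2 * N) W _)) ⟩
      (∑[ z ∈ W ] N * N * 𝟙 (X z ≟ 0)) + (∑[ z ∈ W ] 2 * N * (X z * Q))
        ≡⟨ ∑-distrib-+ W _ _ ⟨
      (∑[ z ∈ W ] N * N * 𝟙 (X z ≟ 0) + 2 * N * (X z * Q))
        ≤⟨ ∑-mono W (λ z → pointwise (X z)) ⟩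
      (∑[ z ∈ W ] (X z * Q) * (X z * Q) + N * N)
        ≡⟨ ∑-distrib-+ W _ _ ⟩
      (∑[ z ∈ W ] (X z * Q) * (X z * Q)) + (∑[ z ∈ W ] N * N)
        ≡⟨ cong ((∑[ z ∈ W ] (X z * Q) * (X z * Q)) +_)
             (trans (∑-const W (N * N)) (trans (cong (_* (N * N)) (length-words L n)) (*-comm (q ^ n) _))) ⟩
      (∑[ z ∈ W ] (X z * Q) * (X z * Q)) + N * N * q ^ n ∎
      where
      lem : ∀ N U q → N * N * (U + q) + N * N * q ≡ N * N * U + 2 * N * (N * q)
      lem = solve-∀

    ∑-square : (∑[ z ∈ W ] (X z * Q) * (X z * Q)) * r ^ t ≡ (∑[ Y ∈ F ] (∑[ Y′ ∈ F ] pairs Y Y′ * (Q * Q)) * r ^ t)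
    ∑-square = begin-equality
      (∑[ z ∈ W ] (X z * Q) * (X z * Q)) * r ^ t
        ≡⟨ cong (_* r ^ t) (∑-cong W λ z → trans (*-interchange (X z) Q (X z) Q)
             (cong (_* (Q * Q)) (sym (∑-product F F _ _)))) ⟩
      (∑[ z ∈ W ] (∑[ Y ∈ F ] ∑[ Y′ ∈ F ] 𝟙 (Y ⊑? viewed z) * 𝟙 (Y′ ⊑? viewed z)) * (Q * Q)) * r ^ t
        ≡⟨ cong (_* r ^ t) (∑-* (Q * Q) W _) ⟨
      (∑[ z ∈ W ] ∑[ Y ∈ F ] ∑[ Y′ ∈ F ] 𝟙 (Y ⊑? viewed z) * 𝟙 (Y′ ⊑? viewed z)) * (Q * Q) * r ^ t
        ≡⟨ cong (λ h → h * (Q * Q) * r ^ t) (trans (∑-swap W F _) (∑-cong F λ Y → ∑-swap W F _)) ⟩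
      (∑[ Y ∈ F ] ∑[ Y′ ∈ F ] pairs Y Y′) * (Q * Q) * r ^ t
        ≡⟨ cong (_* r ^ t) (trans (∑-* (Q * Q) F _) (∑-cong F λ Y → ∑-* (Q * Q) F _)) ⟩
      (∑[ Y ∈ F ] ∑[ Y′ ∈ F ] pairs Y Y′ * (Q * Q)) * r ^ t
        ≡⟨ ∑-* (r ^ t) F _ ⟩
      (∑[ Y ∈ F ] (∑[ Y′ ∈ F ] pairs Y Y′ * (Q * Q)) * r ^ t) ∎

    pair-bound : ∀ Y Y′ → size Y ≡ t → size Y′ ≡ t →
      pairs Y Y′ * (Q * Q) ≤ q ^ n * (∑[ V ∈ subs Y ] 𝟙 (V ⊑? Y′) * q ^ size V)
    pair-bound Y Y′ eq eq′ = subst₂ (λ s s′ → pairs Y Y′ * (q ^ s * q ^ s′) ≤ _) eq eq′ (∑-⊑-⊑-viewed Y Y′)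

    term-bound : ∀ Y V → size Y ≡ t → V ⊑ Y → r ^ size V * degree F V ≤ N →
      q ^ size V * degree F V * r ^ t ≤ N * (q ^ size V * r ^ size (Y ∖ V))
    term-bound Y V eq V⊑Y le = begin
      q ^ size V * degree F V * r ^ t
        ≡⟨ cong (λ s → q ^ size V * degree F V * r ^ s) (trans (sym eq) (sym (size-∖ V⊑Y))) ⟩
      q ^ size V * degree F V * r ^ (size V + size (Y ∖ V))
        ≡⟨ cong (q ^ size V * degree F V *_) (^-distribˡ-+-* r (size V) _) ⟩
      q ^ size V * degree F V * (r ^ size V * r ^ size (Y ∖ V))
        ≡⟨ lem (q ^ size V) (degree F V) (r ^ size V) _ ⟩
      (r ^ size V * degree F V) * (q ^ size V * r ^ size (Y ∖ V))
        ≤⟨ *-monoˡ-≤ _ le ⟩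
      N * (q ^ size V * r ^ size (Y ∖ V)) ∎
      where
      lem : ∀ a b c d → a * b * (c * d) ≡ (c * b) * (a * d)
      lem = solve-∀

    -- For a fixed `Y`, spreadness leaves at most N r^-|V| members `Y′` above each `V`, so the
    -- correlations sum to at most N times the sum of (q/r)^|V| over sub-patterns, which is N (1 +
    -- q/r)^t by `∑-subs`.
    row : ∀ Y → size Y ≡ t → (∀ V → V ⊑ Y → r ^ size V * degree F V ≤ N) →
      (∑[ Y′ ∈ F ] pairs Y Y′ * (Q * Q)) * r ^ t ≤ q ^ n * (N * (q + r) ^ t)
    row Y eq sp = begin
      (∑[ Y′ ∈ F ] pairs Y Y′ * (Q * Q)) * r ^ t
        ≤⟨ *-monoˡ-≤ (r ^ t) (∑-mono-All (All.map (λ {Y′} → pair-bound Y Y′ eq) sizes)) ⟩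
      (∑[ Y′ ∈ F ] q ^ n * (∑[ V ∈ subs Y ] 𝟙 (V ⊑? Y′) * q ^ size V)) * r ^ t
        ≡⟨ cong (_* r ^ t) (trans (sym (*-∑ (q ^ n) F _)) (cong (q ^ n *_) (∑-swap F (subs Y) _))) ⟩
      q ^ n * (∑[ V ∈ subs Y ] ∑[ Y′ ∈ F ] 𝟙 (V ⊑? Y′) * q ^ size V) * r ^ t
        ≡⟨ *-assoc (q ^ n) _ (r ^ t) ⟩
      q ^ n * ((∑[ V ∈ subs Y ] ∑[ Y′ ∈ F ] 𝟙 (V ⊑? Y′) * q ^ size V) * r ^ t)
        ≡⟨ cong (q ^ n *_) (trans (∑-* (r ^ t) (subs Y) _)
             (∑-cong (subs Y) λ V → cong (_* r ^ t) (trans (sym (∑-* (q ^ size V) F _)) (*-comm (degree F V) _)))) ⟩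
      q ^ n * (∑[ V ∈ subs Y ] q ^ size V * degree F V * r ^ t)
        ≤⟨ *-monoʳ-≤ (q ^ n) (∑-mono-All (All.tabulate λ V∈ → let V⊑Y = ∈-subs⁻ Y V∈ in term-bound Y _ eq V⊑Y (sp _ V⊑Y))) ⟩
      q ^ n * (∑[ V ∈ subs Y ] N * (q ^ size V * r ^ size (Y ∖ V)))
        ≡⟨ cong (q ^ n *_) (trans (sym (*-∑ N (subs Y) _)) (cong (N *_) (trans (∑-subs q r Y) (cong ((q + r) ^_) eq)))) ⟩
      q ^ n * (N * (q + r) ^ t) ∎

-- In fractions, (1 + q/r)^t ≤ 1 + t/B. Each step of the induction multiplies B + t by 1 + q/r,
-- which adds at most 1 because q (B + t) ≤ r.
bernoulli : ∀ B q r t → q * (B + t) ≤ r → B * (q + r) ^ t ≤ (B + t) * r ^ t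
bernoulli B q r zero    le = ≤-reflexive (cong (_* 1) (sym (+-identityʳ B)))
bernoulli B q r (suc t) le = begin
  B * ((q + r) * (q + r) ^ t)       ≡⟨ lem₁ B (q + r) ((q + r) ^ t) ⟩
  (q + r) * (B * (q + r) ^ t)       ≤⟨ *-monoʳ-≤ (q + r) (bernoulli B q r t le′) ⟩
  (q + r) * ((B + t) * r ^ t)       ≡⟨ lem₂ q r (B + t) (r ^ t) ⟩
  (q * (B + t) + (B + t) * r) * r ^ t ≤⟨ *-monoˡ-≤ (r ^ t) (+-monoˡ-≤ ((B + t) * r) le′) ⟩
  (r + (B + t) * r) * r ^ t         ≡⟨ lem₃ r B t (r ^ t) ⟩
  (B + suc t) * (r * r ^ t)         ∎
  where
  open ≤-Reasoning
  le′ : q * (B + t) ≤ r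
  le′ = ≤-trans (*-monoʳ-≤ q (+-monoʳ-≤ B (n≤1+n t))) le
  lem₁ : ∀ a b c → a * (b * c) ≡ b * (a * c)
  lem₁ = solve-∀
  lem₂ : ∀ q r b x → (q + r) * (b * x) ≡ (q * b + b * r) * x
  lem₂ = solve-∀
  lem₃ : ∀ r b t x → (r + (b + t) * r) * x ≡ (b + (1 + t)) * (r * x)
  lem₃ = solve-∀

-- Independence of distinct colour classes

∏< : ℕ → (ℕ → ℕ) → ℕ
∏< zero    f = 1
∏< (suc k) f = f k * ∏< k f

∏<-halves : ∀ k {f M} → (∀ {j} → j < k → 2 * f j ≤ M) → 2 ^ k * ∏< k f ≤ M ^ k
∏<-halves zero    le = ≤-refl
∏<-halves (suc k) {f} {M} le = begin
  2 * 2 ^ k * (f k * ∏< k f)     ≡⟨ *-interchange 2 (2 ^ k) (f k) (∏< k f) ⟩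
  (2 * f k) * (2 ^ k * ∏< k f)   ≤⟨ *-mono-≤ (le ≤-refl) (∏<-halves k λ j<k → le (m<n⇒m<1+n j<k)) ⟩
  M * M ^ k                      ∎
  where open ≤-Reasoning

∏<-ones : ∀ k {f} → (∀ j → f j ≡ 1) → ∏< k f ≡ 1
∏<-ones zero    eq = refl
∏<-ones (suc k) eq = cong₂ _*_ (eq k) (∏<-ones k eq)

∏<-cong : ∀ k {f g} → (∀ {j} → j < k → f j ≡ g j) → ∏< k f ≡ ∏< k g
∏<-cong zero    eq = refl
∏<-cong (suc k) eq = cong₂ _*_ (eq ≤-refl) (∏<-cong k λ j<k → eq (m<n⇒m<1+n j<k))

bools : List Bool
bools = false ∷ true ∷ []

points : ∀ n → List (Point n)
points = words bools

∑-points : ∀ n f → ∑ (points (suc n)) f ≡ ∑ (points n) (λ x → f (false ∷ x)) + ∑ (points n) (λ x → f (true ∷ x))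
∑-points n f = trans (∑-words bools n f) (cong (∑ (points n) (λ x → f (false ∷ x)) +_) (+-identityʳ _))

-- A `view` for `SecondMoment` on letters that pair a colour with a bit: among 2ℓ letters exactly
-- one shows a given bit in colour `i`.
see : ℕ → ℕ × Bool → Maybe Bool
see i (j , b) = if does (j ≟ i) then just b else nothing

visible : ℕ → Vec ℕ n → Point n → Pattern n
visible i c x = Vec.map (see i) (zip c x)

visible-⊑ : ∀ i (c : Vec ℕ n) x → visible i c x ⊑ Vec.map just x
visible-⊑ i []      []      = []
visible-⊑ i (j ∷ c) (b ∷ x) with does (j ≟ i)
... | true  = same ∷ visible-⊑ i c x
... | false = free ∷ visible-⊑ i c x

-- Induction on coordinates. If the first coordinate has colour `k` then `G` ignores it, otherwise
-- `F` does; either way one factor takes the same sum on both halves of the cube, and the product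
-- formula survives.
∑-independent : ∀ (c : Vec ℕ n) k F G →
  (∀ x y → visible k c x ≡ visible k c y → F x ≡ F y) →
  (∀ x y → (∀ j → j ≢ k → visible j c x ≡ visible j c y) → G x ≡ G y) →
  (∑[ x ∈ points n ] F x * G x) * 2 ^ n ≡ ∑ (points n) F * ∑ (points n) G
∑-independent {zero} [] k F G F-dep G-dep = lem (F []) (G [])
  where
  lem : ∀ a b → (a * b + 0) * 1 ≡ (a + 0) * (b + 0)
  lem = solve-∀
∑-independent {suc n} (j ∷ c) k F G F-dep G-dep = begin
  (∑[ x ∈ points (suc n) ] F x * G x) * (2 * 2 ^ n)
    ≡⟨ cong (_* (2 * 2 ^ n)) (∑-points n _) ⟩
  ((∑[ x ∈ points n ] F (false ∷ x) * G (false ∷ x)) + (∑[ x ∈ points n ] F (true ∷ x) * G (true ∷ x))) * (2 * 2 ^ n)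
    ≡⟨ lem₁ (∑ (points n) _) _ (2 ^ n) ⟩
  2 * ((∑[ x ∈ points n ] F (false ∷ x) * G (false ∷ x)) * 2 ^ n + (∑[ x ∈ points n ] F (true ∷ x) * G (true ∷ x)) * 2 ^ n)
    ≡⟨ cong (2 *_) (cong₂ _+_ (half false) (half true)) ⟩
  2 * (∑ (points n) (λ x → F (false ∷ x)) * ∑ (points n) (λ x → G (false ∷ x)) +
       ∑ (points n) (λ x → F (true ∷ x)) * ∑ (points n) (λ x → G (true ∷ x)))
    ≡⟨ combine (j ≟ k) ⟩
  (∑ (points n) (λ x → F (false ∷ x)) + ∑ (points n) (λ x → F (true ∷ x))) *
  (∑ (points n) (λ x → G (false ∷ x)) + ∑ (points n) (λ x → G (true ∷ x)))
    ≡⟨ cong₂ _*_ (∑-points n F) (∑-points n G) ⟨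
  ∑ (points (suc n)) F * ∑ (points (suc n)) G ∎
  where
  open ≡-Reasoning
  lem₁ : ∀ a b m → (a + b) * (2 * m) ≡ 2 * (a * m + b * m)
  lem₁ = solve-∀
  lem₂ : ∀ a b m → 2 * (m * a + m * b) ≡ (m + m) * (a + b)
  lem₂ = solve-∀
  lem₃ : ∀ a b m → 2 * (a * m + b * m) ≡ (a + b) * (m + m)
  lem₃ = solve-∀
  half : ∀ b → (∑[ x ∈ points n ] F (b ∷ x) * G (b ∷ x)) * 2 ^ n ≡
               ∑ (points n) (λ x → F (b ∷ x)) * ∑ (points n) (λ x → G (b ∷ x))
  half b = ∑-independent c k _ _
    (λ x y eq → F-dep (b ∷ x) (b ∷ y) (cong (see k (j , b) ∷_) eq))
    (λ x y eq → G-dep (b ∷ x) (b ∷ y) (λ i i≢k → cong (see i (j , b) ∷_) (eq i i≢k)))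
  hidden : ∀ i → j ≢ i → ∀ b b′ → see i (j , b) ≡ see i (j , b′)
  hidden i j≢i b b′ rewrite dec-false (j ≟ i) j≢i = refl
  combine : Dec (j ≡ k) →
    2 * (∑ (points n) (λ x → F (false ∷ x)) * ∑ (points n) (λ x → G (false ∷ x)) +
         ∑ (points n) (λ x → F (true ∷ x)) * ∑ (points n) (λ x → G (true ∷ x))) ≡
    (∑ (points n) (λ x → F (false ∷ x)) + ∑ (points n) (λ x → F (true ∷ x))) *
    (∑ (points n) (λ x → G (false ∷ x)) + ∑ (points n) (λ x → G (true ∷ x)))
  combine (yes refl)
    rewrite ∑-cong (points n) {λ x → G (false ∷ x)} {λ x → G (true ∷ x)}
      (λ x → G-dep (false ∷ x) (true ∷ x) λ i i≢j → cong (_∷ _) (hidden i (i≢j ∘ sym) false true)) =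
    lem₃ (∑ (points n) λ x → F (false ∷ x)) (∑ (points n) λ x → F (true ∷ x)) (∑ (points n) λ x → G (true ∷ x))
  combine (no j≢k)
    rewrite ∑-cong (points n) {λ x → F (false ∷ x)} {λ x → F (true ∷ x)}
      (λ x → F-dep (false ∷ x) (true ∷ x) (cong (_∷ _) (hidden k j≢k false true))) =
    lem₂ (∑ (points n) λ x → G (false ∷ x)) (∑ (points n) λ x → G (true ∷ x)) (∑ (points n) λ x → F (true ∷ x))

-- Peels off the last colour: the product over the colours below `k` depends only on classes other
-- than `k`, so `∑-independent` applies.
∑-∏<-independent : ∀ (c : Vec ℕ n) (h : ℕ → Point n → ℕ) →
  (∀ j x y → visible j c x ≡ visible j c y → h j x ≡ h j y) → ∀ k →
  (∑[ x ∈ points n ] ∏< k (λ j → h j x)) * (2 ^ n) ^ k ≡ 2 ^ n * ∏< k (λ j → ∑ (points n) (h j))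
∑-∏<-independent {n} c h dep zero = cong (_* 1) (trans (sym (length≡∑ (points n))) (length-words bools n))
∑-∏<-independent {n} c h dep (suc k) = begin
  (∑[ x ∈ points n ] h k x * ∏< k (λ j → h j x)) * (2 ^ n * (2 ^ n) ^ k)
    ≡⟨ *-assoc (∑ (points n) _) (2 ^ n) _ ⟨
  (∑[ x ∈ points n ] h k x * ∏< k (λ j → h j x)) * 2 ^ n * (2 ^ n) ^ k
    ≡⟨ cong (_* (2 ^ n) ^ k) (∑-independent c k (h k) _ (dep k)
         λ x y eq → ∏<-cong k λ j<k → dep _ x y (eq _ (<⇒≢ j<k))) ⟩
  ∑ (points n) (h k) * (∑[ x ∈ points n ] ∏< k (λ j → h j x)) * (2 ^ n) ^ k
    ≡⟨ *-assoc (∑ (points n) (h k)) _ _ ⟩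
  ∑ (points n) (h k) * ((∑[ x ∈ points n ] ∏< k (λ j → h j x)) * (2 ^ n) ^ k)
    ≡⟨ cong (∑ (points n) (h k) *_) (∑-∏<-independent c h dep k) ⟩
  ∑ (points n) (h k) * (2 ^ n * ∏< k (λ j → ∑ (points n) (h j)))
    ≡⟨ lem (∑ (points n) (h k)) (2 ^ n) _ ⟩
  2 ^ n * (∑ (points n) (h k) * ∏< k (λ j → ∑ (points n) (h j))) ∎
  where
  open ≡-Reasoning
  lem : ∀ a b c → a * (b * c) ≡ b * (a * c)
  lem = solve-∀

-- Random colourings and the failure probability of a spread family

∑-words-cartesianProduct : ∀ (L : List A) (M : List B) n f →
  ∑ (words (cartesianProduct L M) n) f ≡ (∑[ c ∈ words L n ] ∑[ x ∈ words M n ] f (zip c x))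
∑-words-cartesianProduct L M zero    f = sym (+-identityʳ _)
∑-words-cartesianProduct L M (suc n) f = begin
  ∑ (words (cartesianProduct L M) (suc n)) f
    ≡⟨ trans (∑-words (cartesianProduct L M) n f) (∑-cartesianProductWith _,_ L M _) ⟩
  (∑[ a ∈ L ] ∑[ b ∈ M ] ∑[ z ∈ words (cartesianProduct L M) n ] f ((a , b) ∷ z))
    ≡⟨ ∑-cong L (λ a → ∑-cong M λ b → ∑-words-cartesianProduct L M n _) ⟩
  (∑[ a ∈ L ] ∑[ b ∈ M ] ∑[ c ∈ words L n ] ∑[ x ∈ words M n ] f ((a , b) ∷ zip c x))
    ≡⟨ ∑-cong L (λ a → ∑-swap M (words L n) _) ⟩
  (∑[ a ∈ L ] ∑[ c ∈ words L n ] ∑[ b ∈ M ] ∑[ x ∈ words M n ] f ((a , b) ∷ zip c x))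
    ≡⟨ ∑-cong L (λ a → ∑-cong (words L n) λ c → ∑-words M n _) ⟨
  (∑[ a ∈ L ] ∑[ c ∈ words L n ] ∑[ x ∈ words M (suc n) ] f (zip (a ∷ c) x))
    ≡⟨ ∑-words L n _ ⟨
  (∑[ c ∈ words L (suc n) ] ∑[ x ∈ words M (suc n) ] f (zip c x)) ∎
  where open ≡-Reasoning

∑-downFrom-≥ : ∀ {k i} → k ≤ i → ∑[ j ∈ downFrom k ] 𝟙 (j ≟ i) ≡ 0
∑-downFrom-≥ {zero}  _  = refl
∑-downFrom-≥ {suc k} le = cong₂ _+_ (𝟙-no (k ≟ _) (<⇒≢ le)) (∑-downFrom-≥ (<⇒≤ le))

∑-downFrom-< : ∀ {k i} → i < k → ∑[ j ∈ downFrom k ] 𝟙 (j ≟ i) ≡ 1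
∑-downFrom-< {suc k} {i} (s≤s i≤k) with m≤n⇒m<n∨m≡n i≤k
... | inj₁ i<k  = cong₂ _+_ (𝟙-no (k ≟ i) (>⇒≢ i<k)) (∑-downFrom-< i<k)
... | inj₂ refl = cong₂ _+_ (𝟙-yes (i ≟ i) refl) (∑-downFrom-≥ {i} ≤-refl)

see-unique : ∀ {ℓ i} → i < ℓ → ∀ b → ∑[ a ∈ cartesianProduct (downFrom ℓ) bools ] 𝟙 (just b ≼? see i a) ≡ 1
see-unique {ℓ} {i} i<ℓ b = trans (∑-cartesianProductWith _,_ (downFrom ℓ) bools _)
  (trans (∑-cong (downFrom ℓ) λ j → letter j b) (∑-downFrom-< i<ℓ))
  where
  letter : ∀ j b → ∑[ b′ ∈ bools ] 𝟙 (just b ≼? see i (j , b′)) ≡ 𝟙 (j ≟ i)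
  letter j b with does (j ≟ i)
  letter j false | true = refl
  letter j true  | true = refl
  letter j false | false = refl
  letter j true  | false = refl

^-distribʳ-* : ∀ k a b → (a * b) ^ k ≡ a ^ k * b ^ k
^-distribʳ-* zero    a b = refl
^-distribʳ-* (suc k) a b = trans (cong (a * b *_) (^-distribʳ-* k a b)) (*-interchange a b _ _)

misses : List (Pattern n) → Pattern n → ℕ
misses F v = 𝟙 (hits F v ≟ 0)

misses-anti : ∀ (F : List (Pattern n)) {u v} → u ⊑ v → misses F v ≤ misses F u
misses-anti F {u} {v} u⊑v = 𝟙-mono (hits F v ≟ 0) (hits F u ≟ 0) λ eq →
  n≤0⇒n≡0 (≤-trans (∑-mono F λ Y → 𝟙-mono (Y ⊑? u) (Y ⊑? v) λ q → ⊑-trans q u⊑v) (≤-reflexive eq))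

-- `r-large` is what `bernoulli` asks for with q = 2ℓ letters, B = 2ℓw and t at most w.
module Coloured (F : List (Pattern n)) {t r ℓ w : ℕ} (0<N : 0 < length F)
  (sizes : All (λ Y → size Y ≡ t) F)
  (spread : Spread r F)
  (t≤w : t ≤ w) (1≤w : 1 ≤ w) (1≤ℓ : 1 ≤ ℓ) (r-large : ℓ * 2 * (2 * ℓ * w + w) ≤ r) where

  private
    instance
      w≢0 : NonZero w
      w≢0 = >-nonZero 1≤w
      ℓ≢0 : NonZero ℓ
      ℓ≢0 = >-nonZero 1≤ℓ

    0<r : 0 < r
    0<r = ≤-trans (*-mono-≤ {1} (*-mono-≤ {1} {ℓ} {1} {2} 1≤ℓ (s≤s z≤n)) (≤-trans 1≤w (m≤n+m w (2 * ℓ * w)))) r-large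

    instance
      rᵗ≢0 : NonZero (r ^ t)
      rᵗ≢0 = m^n≢0 r t {{>-nonZero 0<r}}

    colours : List (Vec ℕ n)
    colours = words (downFrom ℓ) n

    L = cartesianProduct (downFrom ℓ) bools

    length-L : length L ≡ ℓ * 2
    length-L = trans (length≡∑ L) (trans (∑-cartesianProductWith _,_ (downFrom ℓ) bools _)
      (trans (∑-const (downFrom ℓ) 2) (cong (_* 2) (length-downFrom ℓ))))

    missed : ℕ → Vec ℕ n → ℕ
    missed i c = ∑[ x ∈ points n ] misses F (visible i c x)

  -- Over a random colouring and point, Chebyshev gives Pr[class i misses] + 1 ≤ (1 + 2ℓ/r)^t ≤ 1 +
  -- t/(2ℓw), so class `i` misses with probability at most 1/(2ℓ).
  ∑-missed : ∀ {i} → i < ℓ → ℓ * (∑[ c ∈ colours ] 2 * missed i c) ≤ (ℓ * 2) ^ n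
  ∑-missed {i} i<ℓ = +-cancelʳ-≤ (2 * ℓ * Q) _ _ (*-cancelʳ-≤ _ _ w (*-cancelʳ-≤ _ _ (r ^ t) (begin
    (ℓ * (∑[ c ∈ colours ] 2 * missed i c) + 2 * ℓ * Q) * w * r ^ t
      ≡⟨ cong (λ s → (ℓ * s + 2 * ℓ * Q) * w * r ^ t) (*-∑ 2 colours (missed i)) ⟨
    (ℓ * (2 * U) + 2 * ℓ * Q) * w * r ^ t
      ≡⟨ lem₁ ℓ U Q w (r ^ t) ⟩
    2 * ℓ * w * ((U + Q) * r ^ t)
      ≤⟨ *-monoʳ-≤ (2 * ℓ * w) chebyshev ⟩
    2 * ℓ * w * (Q * (ℓ * 2 + r) ^ t)
      ≡⟨ lem₂ (2 * ℓ * w) Q ((ℓ * 2 + r) ^ t) ⟩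
    Q * (2 * ℓ * w * (ℓ * 2 + r) ^ t)
      ≤⟨ *-monoʳ-≤ Q (bernoulli (2 * ℓ * w) (ℓ * 2) r t
           (≤-trans (*-monoʳ-≤ (ℓ * 2) (+-monoʳ-≤ (2 * ℓ * w) t≤w)) r-large)) ⟩
    Q * ((2 * ℓ * w + t) * r ^ t)
      ≤⟨ *-monoʳ-≤ Q (*-monoˡ-≤ (r ^ t) (+-monoʳ-≤ (2 * ℓ * w) t≤w)) ⟩
    Q * ((2 * ℓ * w + w) * r ^ t)
      ≡⟨ lem₃ ℓ Q w (r ^ t) ⟩
    (Q + 2 * ℓ * Q) * w * r ^ t ∎)))
    where
    open ≤-Reasoning
    Q = (ℓ * 2) ^ n
    U = ∑ colours (missed i)
    lem₁ : ∀ l u q w x → (l * (2 * u) + 2 * l * q) * w * x ≡ 2 * l * w * ((u + q) * x)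
    lem₁ = solve-∀
    lem₂ : ∀ a b c → a * (b * c) ≡ b * (a * c)
    lem₂ = solve-∀
    lem₃ : ∀ l q w x → q * ((2 * l * w + w) * x) ≡ (q + 2 * l * q) * w * x
    lem₃ = solve-∀
    chebyshev : (U + Q) * r ^ t ≤ Q * (ℓ * 2 + r) ^ t
    chebyshev = subst₂ (λ u q → (u + q ^ n) * r ^ t ≤ q ^ n * (q + r) ^ t)
      (∑-words-cartesianProduct (downFrom ℓ) bools n _) length-L
      (SecondMoment.∑-unhit L (see i) (see-unique i<ℓ) F t r 0<N sizes spread)

  -- The ℓ failure probabilities are added before averaging, so that one colouring serves every
  -- class at once: each summand is then at most the whole bound, meaning probability at most 1/2.
  good-colouring : ∃[ c ] (∑[ i ∈ downFrom ℓ ] 2 * missed i c) ≤ 2 ^ n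
  good-colouring = ∑-≤⇒∃ colours
    (≤-trans (m^n>0 ℓ n) (≤-reflexive (sym length-colours)))
    (*-cancelˡ-≤ ℓ (begin
      ℓ * (∑[ c ∈ colours ] ∑[ i ∈ downFrom ℓ ] 2 * missed i c)
        ≡⟨ cong (ℓ *_) (∑-swap colours (downFrom ℓ) _) ⟩
      ℓ * (∑[ i ∈ downFrom ℓ ] ∑[ c ∈ colours ] 2 * missed i c)
        ≡⟨ *-∑ ℓ (downFrom ℓ) _ ⟩
      (∑[ i ∈ downFrom ℓ ] ℓ * (∑[ c ∈ colours ] 2 * missed i c))
        ≤⟨ ∑-mono-All (All.tabulate λ i∈ → ∑-missed (∈-downFrom⁻ i∈)) ⟩
      (∑[ i ∈ downFrom ℓ ] (ℓ * 2) ^ n)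
        ≡⟨ trans (∑-const (downFrom ℓ) _) (cong₂ _*_ (length-downFrom ℓ) (^-distribʳ-* n ℓ 2)) ⟩
      ℓ * (ℓ ^ n * 2 ^ n)
        ≡⟨ cong (ℓ *_) (trans (∑-const colours (2 ^ n)) (cong (_* 2 ^ n) length-colours)) ⟨
      ℓ * (∑[ c ∈ colours ] 2 ^ n) ∎))
    where
    open ≤-Reasoning
    length-colours : length colours ≡ ℓ ^ n
    length-colours = trans (length-words (downFrom ℓ) n) (cong (_^ n) (length-downFrom ℓ))

  -- A point that satisfies no member of `F` satisfies none inside any single colour class. For a
  -- good colouring these are ℓ independent events of probability at most 1/2.
  ∑-misses : 2 ^ ℓ * (∑[ x ∈ points n ] misses F (Vec.map just x)) ≤ 2 ^ n
  ∑-misses with good-colouring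
  ... | c , good = *-cancelʳ-≤ _ _ ((2 ^ n) ^ ℓ) {{m^n≢0 (2 ^ n) ℓ {{m^n≢0 2 n}}}} (begin
    2 ^ ℓ * (∑[ x ∈ points n ] misses F (Vec.map just x)) * (2 ^ n) ^ ℓ
      ≤⟨ *-monoˡ-≤ _ (*-monoʳ-≤ (2 ^ ℓ) (∑-mono (points n) in-no-colour)) ⟩
    2 ^ ℓ * (∑[ x ∈ points n ] ∏< ℓ (λ j → misses F (visible j c x))) * (2 ^ n) ^ ℓ
      ≡⟨ *-assoc (2 ^ ℓ) _ _ ⟩
    2 ^ ℓ * ((∑[ x ∈ points n ] ∏< ℓ (λ j → misses F (visible j c x))) * (2 ^ n) ^ ℓ)
      ≡⟨ cong (2 ^ ℓ *_) (∑-∏<-independent c (λ j x → misses F (visible j c x)) (λ j x y eq → cong (misses F) eq) ℓ) ⟩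
    2 ^ ℓ * (2 ^ n * ∏< ℓ (λ j → missed j c))
      ≡⟨ lem (2 ^ ℓ) (2 ^ n) _ ⟩
    2 ^ n * (2 ^ ℓ * ∏< ℓ (λ j → missed j c))
      ≤⟨ *-monoʳ-≤ (2 ^ n) (∏<-halves ℓ λ j<ℓ → ≤-trans (∑-∈ (λ i → 2 * missed i c) (∈-downFrom⁺ j<ℓ)) good) ⟩
    2 ^ n * (2 ^ n) ^ ℓ ∎)
    where
    open ≤-Reasoning
    lem : ∀ a b c → a * (b * c) ≡ b * (a * c)
    lem = solve-∀
    in-no-colour : ∀ x → misses F (Vec.map just x) ≤ ∏< ℓ (λ j → misses F (visible j c x))
    in-no-colour x = 𝟙-≤ (hits F (Vec.map just x) ≟ 0) λ eq → ≤-reflexive (sym (∏<-ones ℓ λ j →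
      ≤-antisym (𝟙-≤ (hits F (visible j c x) ≟ 0) λ _ → ≤-refl)
        (≤-trans (≤-reflexive (sym (𝟙-yes (hits F (Vec.map just x) ≟ 0) eq))) (misses-anti F (visible-⊑ j c x)))))

-- Minimal implicants

patterns : ∀ n → List (Pattern n)
patterns = words (nothing ∷ just false ∷ just true ∷ [])

∈-patterns : (Y : Pattern n) → Y ∈ patterns n
∈-patterns []      = here refl
∈-patterns (p ∷ Y) = ∈-cartesianProductWith⁺ _∷_ (letter p) (∈-patterns Y)
  where
  letter : ∀ p → p ∈ nothing ∷ just false ∷ just true ∷ []
  letter nothing      = here refl
  letter (just false) = there (here refl)
  letter (just true)  = there (there (here refl))

words-unique : ∀ {L : List A} n → Unique L → Unique (words L n)
words-unique zero    L! = [] ∷ []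
words-unique (suc n) L! = Uniqueₚ.cartesianProductWith⁺ _∷_ Vecₚ.∷-injective L! (words-unique n L!)

patterns-unique : ∀ n → Unique (patterns n)
patterns-unique n = words-unique n (((λ ()) ∷ (λ ()) ∷ []) ∷ ((λ ()) ∷ []) ∷ [] ∷ [])

_≟ᵖ_ : (Y Z : Pattern n) → Dec (Y ≡ Z)
_≟ᵖ_ = Vecₚ.≡-dec (Maybeₚ.≡-dec Bool._≟_)

∑-unique-≤1 : ∀ {xs : List A} (_≟ᴬ_ : (x y : A) → Dec (x ≡ y)) → Unique xs → ∀ z → ∑[ x ∈ xs ] 𝟙 (x ≟ᴬ z) ≤ 1
∑-unique-≤1 {xs = []}     _≟ᴬ_ _          z = z≤n
∑-unique-≤1 {xs = x ∷ xs} _≟ᴬ_ (x∉ ∷ xs!) z with x ≟ᴬ z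
... | no _     = ∑-unique-≤1 _≟ᴬ_ xs! z
... | yes refl = ≤-reflexive (cong suc (trans
  (∑-cong-All (All.map (λ {y} z≢y → 𝟙-no (y ≟ᴬ x) (z≢y ∘ sym)) x∉)) (∑-zero xs)))

∑>0⇒∃ : ∀ (xs : List A) f → 0 < ∑ xs f → ∃[ x ] x ∈ xs × 0 < f x
∑>0⇒∃ (x ∷ xs) f lt with f x in eq
... | suc _ = x , here refl , subst (0 <_) (sym eq) z<s
... | zero with ∑>0⇒∃ xs f lt
... | y , y∈ , lt′ = y , there y∈ , lt′

𝟙>0⇒ : ∀ {P : Set} (P? : Dec P) → 0 < 𝟙 P? → P
𝟙>0⇒ (yes p) _ = p

hits⇒∃ : ∀ (F : List (Pattern n)) {v} → 0 < hits F v → ∃[ Y ] Y ∈ F × Y ⊑ v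
hits⇒∃ F {v} lt with ∑>0⇒∃ F _ lt
... | Y , Y∈ , lt′ = Y , Y∈ , 𝟙>0⇒ (Y ⊑? v) lt′

∃⇒hits : ∀ (F : List (Pattern n)) {v Y} → Y ∈ F → Y ⊑ v → 0 < hits F v
∃⇒hits F {v} {Y} Y∈ q = ≤-trans (≤-reflexive (sym (𝟙-yes (Y ⊑? v) q))) (∑-∈ (λ Y → 𝟙 (Y ⊑? v)) Y∈)

fill : Bool → Maybe Bool → Bool
fill x nothing  = x
fill x (just b) = b

-- For uniform `x`, the point `x ◁ Y` is uniform on the subcube of `Y`. All patterns thereby share
-- one sample space, and failures of different patterns can be compared at the same `x`.
_◁_ : Point n → Pattern n → Point n
_◁_ = zipWith fill

◁-satisfied : {Y : Pattern n} {x : Point n} → Y ⊑ Vec.map just x → x ◁ Y ≡ x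
◁-satisfied {x = []}    []         = refl
◁-satisfied {x = _ ∷ _} (free  ∷ q) = cong (_ ∷_) (◁-satisfied q)
◁-satisfied {x = _ ∷ _} (same ∷ q) = cong (_ ∷_) (◁-satisfied q)

-- When `x` already agrees with `Y` outside `Z`, imposing `Z` completes `Y`. This charges a failure
-- of `Z` at `x` to `Y`.
◁-∖ : {Z Y : Pattern n} {x : Point n} → Z ⊑ Y → Y ∖ Z ⊑ Vec.map just x → x ◁ Z ≡ x ◁ Y
◁-∖ {x = []}    []                          []         = refl
◁-∖ {x = _ ∷ _} (same ∷ q)                  (_ ∷ q′)    = cong (_ ∷_) (◁-∖ q q′)
◁-∖ {Y = nothing ∷ _} {x = _ ∷ _} (free ∷ q) (_ ∷ q′)    = cong (_ ∷_) (◁-∖ q q′)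
◁-∖ {Y = just _ ∷ _}  {x = _ ∷ _} (free ∷ q) (same ∷ q′) = cong (_ ∷_) (◁-∖ q q′)

no-constraint : ∀ n → Pattern n
no-constraint n = Vec.replicate n nothing

no-constraint-⊑ : (Y : Pattern n) → no-constraint n ⊑ Y
no-constraint-⊑ []      = []
no-constraint-⊑ (p ∷ Y) = free ∷ no-constraint-⊑ Y

size-no-constraint : ∀ n → size (no-constraint n) ≡ 0
size-no-constraint zero    = refl
size-no-constraint (suc n) = size-no-constraint n

support : Pattern n → Subset.Subset n
support = Vec.map is-just

supports : List (Pattern n) → Subset.Subset n
supports []      = Subset.⊥
supports (Y ∷ F) = support Y Subset.∪ supports F

∣p∪q∣≤∣p∣+∣q∣ : ∀ (p q : Subset.Subset n) → Subset.∣ p Subset.∪ q ∣ ≤ Subset.∣ p ∣ + Subset.∣ q ∣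
∣p∪q∣≤∣p∣+∣q∣ []          []          = z≤n
∣p∪q∣≤∣p∣+∣q∣ (true ∷ p)  (true ∷ q)  = s≤s (≤-trans (∣p∪q∣≤∣p∣+∣q∣ p q) (+-monoʳ-≤ Subset.∣ p ∣ (n≤1+n _)))
∣p∪q∣≤∣p∣+∣q∣ (true ∷ p)  (false ∷ q) = s≤s (∣p∪q∣≤∣p∣+∣q∣ p q)
∣p∪q∣≤∣p∣+∣q∣ (false ∷ p) (true ∷ q)  = ≤-trans (s≤s (∣p∪q∣≤∣p∣+∣q∣ p q)) (≤-reflexive (sym (+-suc _ _)))
∣p∪q∣≤∣p∣+∣q∣ (false ∷ p) (false ∷ q) = ∣p∪q∣≤∣p∣+∣q∣ p q

∣support∣ : (Y : Pattern n) → Subset.∣ support Y ∣ ≡ size Y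
∣support∣ []            = refl
∣support∣ (nothing ∷ Y) = ∣support∣ Y
∣support∣ (just _ ∷ Y)  = cong suc (∣support∣ Y)

∣supports∣ : (F : List (Pattern n)) → Subset.∣ supports F ∣ ≤ ∑ F size
∣supports∣ {n} [] = ≤-reflexive (Subsetₚ.∣⊥∣≡0 n)
∣supports∣ (Y ∷ F) = ≤-trans (∣p∪q∣≤∣p∣+∣q∣ (support Y) (supports F))
  (+-mono-≤ (≤-reflexive (∣support∣ Y)) (∣supports∣ F))

⊑-agree : ∀ {Y : Pattern n} x y → (∀ i → i Subset.∈ support Y → Vec.lookup x i ≡ Vec.lookup y i) →
  Y ⊑ Vec.map just x → Y ⊑ Vec.map just y
⊑-agree []      []      eq []         = []
⊑-agree (_ ∷ x) (_ ∷ y) eq (free ∷ q)  = free ∷ ⊑-agree x y (λ i i∈ → eq (suc i) (Vec.there i∈)) q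
⊑-agree (_ ∷ x) (_ ∷ y) eq (same ∷ q) with refl ← eq zero Vec.here =
  same ∷ ⊑-agree x y (λ i i∈ → eq (suc i) (Vec.there i∈)) q

hits-cong : ∀ (F : List (Pattern n)) x y → (∀ i → i Subset.∈ supports F → Vec.lookup x i ≡ Vec.lookup y i) →
  hits F (Vec.map just x) ≡ hits F (Vec.map just y)
hits-cong []      x y eq = refl
hits-cong (Y ∷ F) x y eq = cong₂ _+_
  (≤-antisym (𝟙-mono (Y ⊑? _) (Y ⊑? _) (⊑-agree x y eqʸ)) (𝟙-mono (Y ⊑? _) (Y ⊑? _) (⊑-agree y x λ i i∈ → sym (eqʸ i i∈))))
  (hits-cong F x y λ i i∈ → eq i (Subsetₚ.q⊆p∪q (support Y) _ i∈))
  where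
  eqʸ : ∀ i → i Subset.∈ support Y → Vec.lookup x i ≡ Vec.lookup y i
  eqʸ i i∈ = eq i (Subsetₚ.p⊆p∪q _ i∈)

module Implicants (f : BoolFun n) (d : ℕ → ℕ) where

  failures : Pattern n → ℕ
  failures Y = ∑[ x ∈ points n ] 𝟙 (f (x ◁ Y) Bool.≟ false)

  Implicant : Pattern n → Set
  Implicant Y = 2 ^ d (size Y) * failures Y ≤ 2 ^ n

  implicant? : ∀ Y → Dec (Implicant Y)
  implicant? Y = _ ≤? _

  -- For a sub-pattern, having the same size means being equal, by `⊑-size⇒≡`; comparing sizes over
  -- the finite list `subs Y` keeps the notion decidable.
  Minimal : Pattern n → Set
  Minimal Y = Implicant Y × All (λ Z → Implicant Z → size Z ≡ size Y) (subs Y)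

  minimal? : ∀ Y → Dec (Minimal Y)
  minimal? Y = implicant? Y ×-dec All.all? (λ Z → implicant? Z →-dec (size Z ≟ size Y)) (subs Y)

  minimals : ℕ → List (Pattern n)
  minimals s = filter (λ Y → (size Y ≟ s) ×-dec minimal? Y) (patterns n)

  minimal-below : ∀ Y → Implicant Y → ∃[ Z ] Z ⊑ Y × Minimal Z
  minimal-below Y = go (size Y) Y ≤-refl
    where
    go : ∀ k Y → size Y ≤ k → Implicant Y → ∃[ Z ] Z ⊑ Y × Minimal Z
    go k Y le imp with Any.any? (λ Z → implicant? Z ×-dec ¬? (size Z ≟ size Y)) (subs Y)
    ... | no none = Y , ⊑-refl , imp , All.tabulate λ {Z} Z∈ impZ →
      decidable-stable (size Z ≟ size Y) λ ≢ → none (lose Z∈ (impZ , ≢))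
    ... | yes some with find some
    ... | Z , Z∈ , impZ , ≢ with ≤∧≢⇒< (size-mono (∈-subs⁻ Y Z∈)) ≢ | k
    ... | lt | zero  = contradiction (≤-trans lt le) λ ()
    ... | lt | suc k with go k Z (≤-pred (≤-trans lt le)) impZ
    ... | X , X⊑Z , min = X , ⊑-trans X⊑Z (∈-subs⁻ Y Z∈) , min

  -- The two conditions on `d` each pay for half of the allowed failure of a smaller pattern: `d<ℓ`
  -- covers the points missing the link, and `d-steep` covers the total failure of r^s + 1
  -- implicants of size s.
  module Count (w ℓ r : ℕ) (1≤w : 1 ≤ w) (1≤ℓ : 1 ≤ ℓ)
    (r-large : ℓ * 2 * (2 * ℓ * w + w) ≤ r)
    (d<ℓ : ∀ {t} → t < w → d t < ℓ)
    (d-steep : ∀ {t s} → t < s → s ≤ w → 2 ^ suc (d t) * suc (r ^ s) ≤ 2 ^ d s) where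

    private
      instance
        r≢0 : NonZero r
        r≢0 = >-nonZero (≤-trans (*-mono-≤ {1} (*-mono-≤ {1} {ℓ} {1} {2} 1≤ℓ (s≤s z≤n)) (≤-trans 1≤w (m≤n+m w (2 * ℓ * w)))) r-large)

    -- Refutes the existence of more than r^s minimal implicants of size s. `M` holds exactly one
    -- too many, which keeps the sum of their failures within `d-steep`.
    module Excess {s} (s≤w : s ≤ w) (M : List (Pattern n)) (length-M : length M ≡ suc (r ^ s))
      (M-unique : Unique M) (M-minimal : All (λ Y → size Y ≡ s × Minimal Y) M)
      (Z : Pattern n) (Z-max : ∀ V → r ^ size V * degree M V ≤ r ^ size Z * degree M Z) where

      score : Pattern n → ℕ
      score Z = r ^ size Z * degree M Z

      -- The empty pattern lies below every member, so it already scores the length of `M`.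
      score-Z : r ^ s < score Z
      score-Z = begin
        suc (r ^ s)              ≡⟨ trans (sym length-M) (length≡∑ M) ⟩
        (∑[ Y ∈ M ] 1)           ≡⟨ ∑-cong M (λ Y → 𝟙-yes (no-constraint n ⊑? Y) (no-constraint-⊑ Y)) ⟨
        degree M (no-constraint n) ≡⟨ trans (cong (λ k → r ^ k * degree M (no-constraint n)) (size-no-constraint n)) (*-identityˡ _) ⟨
        score (no-constraint n)  ≤⟨ Z-max (no-constraint n) ⟩
        score Z                  ∎
        where open ≤-Reasoning

      degree-Z : 0 < degree M Z
      degree-Z = n≢0⇒n>0 λ eq →
        contradiction (subst (λ k → r ^ s < r ^ size Z * k) eq score-Z)
          (≤⇒≯ (≤-trans (≤-reflexive (*-zeroʳ (r ^ size Z))) z≤n))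

      -- Members of `M` are distinct and of size s, so a pattern of size s has degree at most 1 and
      -- scores at most r^s, too little for `Z`.
      size-Z : size Z < s
      size-Z with ∑>0⇒∃ M _ degree-Z
      ... | Y₀ , Y₀∈ , lt = ≤∧≢⇒< Z≤s λ eq → contradiction score-Z (≤⇒≯ (begin
        r ^ size Z * degree M Z
          ≤⟨ *-monoʳ-≤ (r ^ size Z) (∑-mono-All (All.map (λ {Y} (size-Y , _) → only-Z eq Y size-Y) M-minimal)) ⟩
        r ^ size Z * (∑[ Y ∈ M ] 𝟙 (Y ≟ᵖ Z))
          ≤⟨ *-monoʳ-≤ (r ^ size Z) (∑-unique-≤1 _≟ᵖ_ M-unique Z) ⟩
        r ^ size Z * 1
          ≡⟨ trans (*-identityʳ _) (cong (r ^_) eq) ⟩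
        r ^ s ∎))
        where
        open ≤-Reasoning
        Z≤s : size Z ≤ s
        Z≤s = ≤-trans (size-mono (𝟙>0⇒ (Z ⊑? Y₀) lt)) (≤-reflexive (proj₁ (All.lookup M-minimal Y₀∈)))
        only-Z : size Z ≡ s → ∀ Y → size Y ≡ s → 𝟙 (Z ⊑? Y) ≤ 𝟙 (Y ≟ᵖ Z)
        only-Z eq Y size-Y = 𝟙-mono (Z ⊑? Y) (Y ≟ᵖ Z)
          λ q → sym (⊑-size⇒≡ q (≤-reflexive (trans size-Y (sym eq))))

      link : List (Pattern n)
      link = map (_∖ Z) (filter (Z ⊑?_) M)

      length-link : length link ≡ degree M Z
      length-link = trans (length-map (_∖ Z) (filter (Z ⊑?_) M)) (length-filter≡∑ (Z ⊑?_) M)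

      ∈-link⁻ : ∀ {U} → U ∈ link → ∃[ Y ] Y ∈ M × U ≡ Y ∖ Z × Z ⊑ Y
      ∈-link⁻ = ∈-map∘filter⁻ (_∖ Z) (Z ⊑?_)

      link-sizes : All (λ U → size U ≡ s ∸ size Z) link
      link-sizes = All.tabulate λ U∈ → case (∈-link⁻ U∈)
        where
        case : ∀ {U} → ∃[ Y ] Y ∈ M × U ≡ Y ∖ Z × Z ⊑ Y → size U ≡ s ∸ size Z
        case (Y , Y∈ , refl , Z⊑Y) = sym (begin
          s ∸ size Z                            ≡⟨ cong (_∸ size Z) (proj₁ (All.lookup M-minimal Y∈)) ⟨
          size Y ∸ size Z                       ≡⟨ cong (_∸ size Z) (size-∖ Z⊑Y) ⟨
          (size Z + size (Y ∖ Z)) ∸ size Z      ≡⟨ m+n∸m≡n (size Z) _ ⟩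
          size (Y ∖ Z)                          ∎)
          where open ≡-Reasoning

      -- A member of the link above `V` comes from a member of `M` above `V ∪ Z`. Maximality of the
      -- score of `Z` against `V ∪ Z` is spreadness at `V` after cancelling r^|Z|.
      link-spread : Spread r link
      link-spread = All.tabulate λ U∈ V V⊑U → case (∈-link⁻ U∈) V V⊑U
        where
        case : ∀ {U} → ∃[ Y ] Y ∈ M × U ≡ Y ∖ Z × Z ⊑ Y → ∀ V → V ⊑ U →
          r ^ size V * degree link V ≤ length link
        case (Y , Y∈ , refl , Z⊑Y) V V⊑U = *-cancelˡ-≤ (r ^ size Z) {{m^n≢0 r (size Z)}} (begin
          r ^ size Z * (r ^ size V * degree link V)
            ≡⟨ lem (r ^ size Z) (r ^ size V) _ ⟩
          r ^ size V * r ^ size Z * degree link V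
            ≡⟨ cong₂ _*_ (trans (sym (^-distribˡ-+-* r (size V) (size Z))) (cong (r ^_) (sym (size-∪ Z V⊑U))))
                         (trans (∑-map (_∖ Z) (filter (Z ⊑?_) M) _) (∑-filter (Z ⊑?_) M _)) ⟩
          r ^ size (V ∪ Z) * (∑[ Y ∈ M ] 𝟙 (Z ⊑? Y) * 𝟙 (V ⊑? (Y ∖ Z)))
            ≤⟨ *-monoʳ-≤ (r ^ size (V ∪ Z)) (∑-mono M λ Y → both Y (Z ⊑? Y) (V ⊑? (Y ∖ Z))) ⟩
          score (V ∪ Z)
            ≤⟨ Z-max (V ∪ Z) ⟩
          r ^ size Z * degree M Z
            ≡⟨ cong (r ^ size Z *_) length-link ⟨
          r ^ size Z * length link ∎)
          where
          open ≤-Reasoning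
          lem : ∀ a b c → a * (b * c) ≡ b * a * c
          lem = solve-∀
          both : ∀ Y (P? : Dec (Z ⊑ Y)) (Q? : Dec (V ⊑ Y ∖ Z)) → 𝟙 P? * 𝟙 Q? ≤ 𝟙 ((V ∪ Z) ⊑? Y)
          both Y (yes p) (yes q) = ≤-reflexive (sym (𝟙-yes ((V ∪ Z) ⊑? Y) (∪-⊑ q p)))
          both Y (yes p) (no _)  = z≤n
          both Y (no _)  _       = z≤n

      link-misses : 2 ^ ℓ * (∑[ x ∈ points n ] misses link (Vec.map just x)) ≤ 2 ^ n
      link-misses = Coloured.∑-misses link (≤-trans degree-Z (≤-reflexive (sym length-link))) link-sizes link-spread
        (≤-trans (m∸n≤m s (size Z)) s≤w) 1≤w 1≤ℓ r-large

      -- Either `x` misses the whole link, or it satisfies the part of some `Y` beyond `Z`; then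
      -- `x ◁ Z` and `x ◁ Y` coincide and the failure is counted for `Y`.
      failures-Z : failures Z ≤ (∑[ x ∈ points n ] misses link (Vec.map just x)) + ∑ M failures
      failures-Z = begin
        failures Z
          ≤⟨ ∑-mono (points n) pointwise ⟩
        (∑[ x ∈ points n ] misses link (Vec.map just x) + (∑[ Y ∈ M ] 𝟙 (f (x ◁ Y) Bool.≟ false)))
          ≡⟨ ∑-distrib-+ (points n) _ _ ⟩
        (∑[ x ∈ points n ] misses link (Vec.map just x)) + (∑[ x ∈ points n ] ∑[ Y ∈ M ] 𝟙 (f (x ◁ Y) Bool.≟ false))
          ≡⟨ cong ((∑[ x ∈ points n ] misses link (Vec.map just x)) +_) (∑-swap (points n) M _) ⟩
        (∑[ x ∈ points n ] misses link (Vec.map just x)) + ∑ M failures ∎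
        where
        open ≤-Reasoning
        pointwise : ∀ x → 𝟙 (f (x ◁ Z) Bool.≟ false) ≤
          misses link (Vec.map just x) + (∑[ Y ∈ M ] 𝟙 (f (x ◁ Y) Bool.≟ false))
        pointwise x = split (hits link (Vec.map just x) ≟ 0)
          where
          split : (P? : Dec (hits link (Vec.map just x) ≡ 0)) → 𝟙 (f (x ◁ Z) Bool.≟ false) ≤
            𝟙 P? + (∑[ Y ∈ M ] 𝟙 (f (x ◁ Y) Bool.≟ false))
          split (yes _) = ≤-trans (𝟙-≤ (f (x ◁ Z) Bool.≟ false) λ _ → ≤-refl) (m≤m+n 1 _)
          split (no hit) with hits⇒∃ link (n≢0⇒n>0 hit)
          ... | U , U∈ , U⊑x with ∈-link⁻ U∈
          ... | Y , Y∈ , refl , Z⊑Y =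
            ≤-trans (≤-reflexive (cong (λ y → 𝟙 (f y Bool.≟ false)) (◁-∖ Z⊑Y U⊑x)))
                    (∑-∈ (λ Y → 𝟙 (f (x ◁ Y) Bool.≟ false)) Y∈)

      ∑-failures : 2 ^ suc (d (size Z)) * ∑ M failures ≤ 2 ^ n
      ∑-failures = *-cancelˡ-≤ (suc (r ^ s)) (begin
        suc (r ^ s) * (2 ^ suc (d (size Z)) * ∑ M failures)
          ≡⟨ lem (suc (r ^ s)) (2 ^ suc (d (size Z))) _ ⟩
        2 ^ suc (d (size Z)) * suc (r ^ s) * ∑ M failures
          ≡⟨ *-∑ (2 ^ suc (d (size Z)) * suc (r ^ s)) M failures ⟩
        (∑[ Y ∈ M ] 2 ^ suc (d (size Z)) * suc (r ^ s) * failures Y)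
          ≤⟨ ∑-mono-All (All.map (λ {Y} (size-Y , imp , _) →
               ≤-trans (*-monoˡ-≤ (failures Y) (≤-trans (d-steep size-Z s≤w) (≤-reflexive (cong (λ k → 2 ^ d k) (sym size-Y))))) imp) M-minimal) ⟩
        (∑[ Y ∈ M ] 2 ^ n)
          ≡⟨ trans (∑-const M _) (cong (_* 2 ^ n) length-M) ⟩
        suc (r ^ s) * 2 ^ n ∎)
        where
        open ≤-Reasoning
        lem : ∀ a b c → a * (b * c) ≡ b * a * c
        lem = solve-∀

      implicant-Z : Implicant Z
      implicant-Z = *-cancelˡ-≤ 2 (begin
        2 * (2 ^ d (size Z) * failures Z)
          ≡⟨ *-assoc 2 (2 ^ d (size Z)) _ ⟨
        2 ^ suc (d (size Z)) * failures Z
          ≤⟨ *-monoʳ-≤ (2 ^ suc (d (size Z))) failures-Z ⟩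
        2 ^ suc (d (size Z)) * ((∑[ x ∈ points n ] misses link (Vec.map just x)) + ∑ M failures)
          ≡⟨ *-distribˡ-+ (2 ^ suc (d (size Z))) _ _ ⟩
        2 ^ suc (d (size Z)) * (∑[ x ∈ points n ] misses link (Vec.map just x)) + 2 ^ suc (d (size Z)) * ∑ M failures
          ≤⟨ +-mono-≤ (≤-trans (*-monoˡ-≤ _ (^-monoʳ-≤ 2 (d<ℓ (≤-trans size-Z s≤w)))) link-misses) ∑-failures ⟩
        2 ^ n + 2 ^ n
          ≡⟨ cong (2 ^ n +_) (+-identityʳ (2 ^ n)) ⟨
        2 * 2 ^ n ∎)
        where open ≤-Reasoning

      -- Some member of `M` extends `Z`, and `Z` is a strictly smaller implicant, against
      -- minimality.
      contradictory : ⊥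
      contradictory with ∑>0⇒∃ M _ degree-Z
      ... | Y , Y∈ , lt with All.lookup M-minimal Y∈
      ... | size-Y , _ , min = <⇒≢ size-Z (trans (All.lookup min (∈-subs⁺ (𝟙>0⇒ (Z ⊑? Y) lt)) implicant-Z) size-Y)

    length-minimals : ∀ {s} → s ≤ w → length (minimals s) ≤ r ^ s
    length-minimals {s} s≤w = ≮⇒≥ λ many → Excess.contradictory s≤w M
      (trans (length-take (suc (r ^ s)) (minimals s)) (m≤n⇒m⊓n≡m many))
      (Uniqueₚ.take⁺ (suc (r ^ s)) (Uniqueₚ.filter⁺ _ (patterns-unique n)))
      (Allₚ.take⁺ (suc (r ^ s)) (Allₚ.all-filter _ (patterns n)))
      -- The maximum is over all patterns, so that it also dominates every `V ∪ Z`; that `Z` lies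
      -- below a member of `M` follows from its positive degree.
      (argmax score (no-constraint n) (patterns n))
      (λ V → All.lookup (f[xs]≤f[argmax] {f = score} (no-constraint n) (patterns n)) (∈-patterns V))
      where
      M : List (Pattern n)
      M = take (suc (r ^ s)) (minimals s)
      score : Pattern n → ℕ
      score V = r ^ size V * degree M V

    module Approximation (d-least : ∀ s → d 0 ≤ d s)
      (certificate : ∀ x → f x ≡ true → ∃[ Y ] size Y ≤ w × Y ⊑ Vec.map just x × (∀ y → f (y ◁ Y) ≡ true)) where

      core : List (Pattern n)
      core = concatMap minimals (downFrom (suc w))

      approximator : BoolFun n
      approximator x = does (0 <? hits core (Vec.map just x))

      ∈-core⁺ : ∀ {Y} → size Y ≤ w → Minimal Y → Y ∈ core
      ∈-core⁺ {Y} le min = ∈-concatMap⁺ minimals (lose (∈-downFrom⁺ (s≤s le))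
        (∈-filter⁺ (λ Y′ → (size Y′ ≟ size Y) ×-dec minimal? Y′) (∈-patterns Y) (refl , min)))

      ∈-core⁻ : ∀ {Y} → Y ∈ core → size Y ≤ w × Minimal Y
      ∈-core⁻ {Y} Y∈ with find (∈-concatMap⁻ minimals {xs = downFrom (suc w)} Y∈)
      ... | s , s∈ , Y∈s with ∈-filter⁻ (λ Y′ → (size Y′ ≟ s) ×-dec minimal? Y′) {xs = patterns n} Y∈s
      ... | _ , refl , min = ≤-pred (∈-downFrom⁻ s∈) , min

      length-core : length core ≤ suc w * r ^ w
      length-core = begin
        length core
          ≡⟨ length-concatMap (downFrom (suc w)) ⟩
        (∑[ s ∈ downFrom (suc w) ] length (minimals s))
          ≤⟨ ∑-mono-All (All.tabulate λ s∈ → let s≤w = ≤-pred (∈-downFrom⁻ s∈) in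
               ≤-trans (length-minimals s≤w) (^-monoʳ-≤ r s≤w)) ⟩
        (∑[ s ∈ downFrom (suc w) ] r ^ w)
          ≡⟨ trans (∑-const (downFrom (suc w)) (r ^ w)) (cong (_* r ^ w) (length-downFrom (suc w))) ⟩
        suc w * r ^ w ∎
        where
        open ≤-Reasoning
        length-concatMap : ∀ ss → length (concatMap minimals ss) ≡ ∑[ s ∈ ss ] length (minimals s)
        length-concatMap []       = refl
        length-concatMap (s ∷ ss) = trans (length-++ (minimals s)) (cong (length (minimals s) +_) (length-concatMap ss))

      -- A certificate never fails, so it is an implicant at every level of `d`. A minimal implicant
      -- inside it has size at most w and is satisfied by `x` as well.
      certified : ∀ x → f x ≡ true → approximator x ≡ true
      certified x fx with certificate x fx
      ... | Y , Y≤w , Y⊑x , forced with minimal-below Y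
          (≤-trans (≤-reflexive (trans (cong (2 ^ d (size Y) *_) no-failure) (*-zeroʳ (2 ^ d (size Y))))) z≤n)
        where
        no-failure : failures Y ≡ 0
        no-failure = trans (∑-cong (points n) λ y → 𝟙-no (f (y ◁ Y) Bool.≟ false)
          λ eq → case trans (sym eq) (forced y) of λ ()) (∑-zero (points n))
      ... | Z , Z⊑Y , min = dec-true (0 <? hits core (Vec.map just x))
        (∃⇒hits core (∈-core⁺ (≤-trans (size-mono Z⊑Y) Y≤w) min) (⊑-trans Z⊑Y Y⊑x))

      -- By `certified` an error means f = 0 and g = 1. Then `x` satisfies some `Y` in `core`, so
      -- `x ◁ Y` is `x` itself and `Y` fails there.
      error : ∀ x → 𝟙 (¬? (f x Bool.≟ approximator x)) ≤ (∑[ Y ∈ core ] 𝟙 (f (x ◁ Y) Bool.≟ false))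
      error x = 𝟙-≤ (¬? (f x Bool.≟ approximator x)) λ f≢g → locate (f x) refl (0 <? hits core (Vec.map just x)) f≢g
        where
        locate : ∀ b → f x ≡ b → (hit? : Dec (0 < hits core (Vec.map just x))) → f x ≢ does hit? →
          1 ≤ (∑[ Y ∈ core ] 𝟙 (f (x ◁ Y) Bool.≟ false))
        locate true  fx hit?      f≢g = contradiction (trans fx (sym (trans (does-≡ hit? (0 <? hits core (Vec.map just x))) (certified x fx)))) f≢g
        locate false fx (no _)    f≢g = contradiction fx f≢g
        locate false fx (yes hit) f≢g with hits⇒∃ core hit
        ... | Y , Y∈ , Y⊑x = ≤-trans
          (≤-reflexive (sym (𝟙-yes (f (x ◁ Y) Bool.≟ false) (trans (cong f (◁-satisfied Y⊑x)) fx))))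
          (∑-∈ (λ Y → 𝟙 (f (x ◁ Y) Bool.≟ false)) Y∈)

      ∑-error : 2 ^ d 0 * (∑[ x ∈ points n ] 𝟙 (¬? (f x Bool.≟ approximator x))) ≤ suc w * r ^ w * 2 ^ n
      ∑-error = begin
        2 ^ d 0 * (∑[ x ∈ points n ] 𝟙 (¬? (f x Bool.≟ approximator x)))
          ≤⟨ *-monoʳ-≤ (2 ^ d 0) (≤-trans (∑-mono (points n) error) (≤-reflexive (∑-swap (points n) core _))) ⟩
        2 ^ d 0 * ∑ core failures
          ≡⟨ *-∑ (2 ^ d 0) core failures ⟩
        (∑[ Y ∈ core ] 2 ^ d 0 * failures Y)
          ≤⟨ ∑-mono-All (All.tabulate λ {Y} Y∈ → ≤-trans (*-monoˡ-≤ (failures Y) (^-monoʳ-≤ 2 (d-least (size Y)))) (proj₁ (proj₂ (∈-core⁻ Y∈)))) ⟩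
        (∑[ Y ∈ core ] 2 ^ n)
          ≡⟨ ∑-const core (2 ^ n) ⟩
        length core * 2 ^ n
          ≤⟨ *-monoˡ-≤ (2 ^ n) length-core ⟩
        suc w * r ^ w * 2 ^ n ∎
        where open ≤-Reasoning

      junta : IsJunta (suc w * r ^ w * w) approximator
      junta = supports core , ≤-trans (∣supports∣ core) (begin
          ∑ core size          ≤⟨ ∑-mono-All (All.tabulate λ Y∈ → proj₁ (∈-core⁻ Y∈)) ⟩
          (∑[ Y ∈ core ] w)    ≡⟨ ∑-const core w ⟩
          length core * w      ≤⟨ *-monoˡ-≤ w length-core ⟩
          suc w * r ^ w * w    ∎)
        , λ x y agree → cong (λ h → does (0 <? h)) (hits-cong core x y agree)
        where open ≤-Reasoning

-- Formulas in disjunctive normal form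

variableOf : Literal n → Fin n
variableOf (pos i) = i
variableOf (neg i) = i

-- Values are read off `x` instead of the literals. If `x` satisfies the term the two agree, and
-- repeated variables are set consistently.
restriction : Term n → Point n → Pattern n
restriction []      x = no-constraint _
restriction (l ∷ t) x = restriction t x Vec.[ variableOf l ]≔ just (Vec.lookup x (variableOf l))

size-≔ : ∀ (Y : Pattern n) i b → size (Y Vec.[ i ]≔ just b) ≤ suc (size Y)
size-≔ (p ∷ Y) zero    b = s≤s (m≤n+m (size Y) (size₁ p))
size-≔ (p ∷ Y) (suc i) b = ≤-trans (+-monoʳ-≤ (size₁ p) (size-≔ Y i b)) (≤-reflexive (+-suc (size₁ p) (size Y)))

size-restriction : ∀ (t : Term n) x → size (restriction t x) ≤ length t
size-restriction {n} []  x = ≤-reflexive (size-no-constraint n)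
size-restriction (l ∷ t) x = ≤-trans (size-≔ (restriction t x) (variableOf l) _) (s≤s (size-restriction t x))

≔-⊑ : ∀ {Y : Pattern n} x i → Y ⊑ Vec.map just x → Y Vec.[ i ]≔ just (Vec.lookup x i) ⊑ Vec.map just x
≔-⊑ (b ∷ x) zero    (_ ∷ q) = same ∷ q
≔-⊑ (b ∷ x) (suc i) (p ∷ q) = p ∷ ≔-⊑ x i q

restriction-⊑ : ∀ (t : Term n) x → restriction t x ⊑ Vec.map just x
restriction-⊑ []      x = no-constraint-⊑ _
restriction-⊑ (l ∷ t) x = ≔-⊑ x (variableOf l) (restriction-⊑ t x)

lookup-restriction : ∀ {l} (t : Term n) x → l ∈ t →
  Vec.lookup (restriction t x) (variableOf l) ≡ just (Vec.lookup x (variableOf l))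
lookup-restriction (l ∷ t) x (here refl) = Vecₚ.lookup∘update (variableOf l) (restriction t x) _
lookup-restriction {l = l} (l′ ∷ t) x (there l∈) with variableOf l Fin.≟ variableOf l′
... | yes eq = trans (cong (Vec.lookup (restriction (l′ ∷ t) x)) eq)
  (trans (Vecₚ.lookup∘update (variableOf l′) (restriction t x) _) (cong (λ i → just (Vec.lookup x i)) (sym eq)))
... | no neq = trans (Vecₚ.lookup∘update′ neq (restriction t x) _) (lookup-restriction t x l∈)

evalLiteral-restriction : ∀ {l} (t : Term n) x y → l ∈ t → evalLiteral l (y ◁ restriction t x) ≡ evalLiteral l x
evalLiteral-restriction {l = l} t x y l∈ = go l (begin
  Vec.lookup (y ◁ restriction t x) (variableOf l)                              ≡⟨ Vecₚ.lookup-zipWith fill (variableOf l) y (restriction t x) ⟩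
  fill (Vec.lookup y (variableOf l)) (Vec.lookup (restriction t x) (variableOf l)) ≡⟨ cong (fill _) (lookup-restriction t x l∈) ⟩
  Vec.lookup x (variableOf l)                                                  ∎)
  where
  open ≡-Reasoning
  go : ∀ l {x y} → Vec.lookup x (variableOf l) ≡ Vec.lookup y (variableOf l) → evalLiteral l x ≡ evalLiteral l y
  go (pos i) eq = eq
  go (neg i) eq = cong not eq

all-cong : ∀ {p q : A → Bool} xs → (∀ {x} → x ∈ xs → p x ≡ q x) → all p xs ≡ all q xs
all-cong []       eq = refl
all-cong (x ∷ xs) eq = cong₂ _∧_ (eq (here refl)) (all-cong xs (eq ∘ there))

any⇒∃ : ∀ (p : A → Bool) xs → any p xs ≡ true → ∃[ x ] x ∈ xs × p x ≡ true
any⇒∃ p (x ∷ xs) eq with p x in px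
... | true  = x , here refl , px
... | false with any⇒∃ p xs eq
... | y , y∈ , py = y , there y∈ , py

∃⇒any : ∀ (p : A → Bool) {xs x} → x ∈ xs → p x ≡ true → any p xs ≡ true
∃⇒any p (here refl) eq rewrite eq = refl
∃⇒any p {y ∷ _} (there x∈) eq with p y
... | true  = refl
... | false = ∃⇒any p x∈ eq

-- A term satisfied by `x` stays satisfied once its variables are frozen at their values in `x`, and
-- they number at most w.
DNF-certificate : ∀ {w} {f : BoolFun n} (φ : DNF n) → HasWidth w φ → Computes φ f → ∀ x → f x ≡ true →
  ∃[ Y ] size Y ≤ w × Y ⊑ Vec.map just x × (∀ y → f (y ◁ Y) ≡ true)
DNF-certificate φ width comp x fx with any⇒∃ _ φ (trans (comp x) fx)
... | t , t∈ , tx = restriction t x , ≤-trans (size-restriction t x) (All.lookup width t∈) , restriction-⊑ t x ,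
  λ y → trans (sym (comp _)) (∃⇒any _ t∈ (trans (all-cong t (evalLiteral-restriction t x y)) tx))

-- Choice of the parameters

power-of-two-above : ∀ k → 1 ≤ k → ∃[ L ] k ≤ 2 ^ L × 2 ^ L ≤ 2 * k
power-of-two-above (suc zero) _ = 0 , ≤-refl , s≤s z≤n
power-of-two-above (suc k@(suc _)) _ with power-of-two-above k z<s
... | L , lo , hi with suc k ≤? 2 ^ L
... | yes lo′ = L , lo′ , ≤-trans hi (*-monoʳ-≤ 2 (n≤1+n k))
... | no  k≮  = suc L , ≤-trans (+-mono-≤ {1} {k} {k} z<s ≤-refl) (≤-trans (≤-reflexive (cong (k +_) (sym (+-identityʳ k)))) (*-monoʳ-≤ 2 lo)) ,
  *-monoʳ-≤ 2 (≤-trans (≤-pred (≰⇒> k≮)) (n≤1+n k))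

n<2^n : ∀ k → k < 2 ^ k
n<2^n zero    = s≤s z≤n
n<2^n (suc k) = ≤-trans (+-mono-≤ {1} {2 ^ k} (m^n>0 2 k) (n<2^n k)) (≤-reflexive (cong (2 ^ k +_) (sym (+-identityʳ _))))

module Parameters (w m L : ℕ) (1≤w : 1 ≤ w) (2≤m : 2 ≤ m) (wm≤P : w * m ≤ 2 ^ L) where

  -- `P` is w m rounded up to a power of two, so r = P^22 and r^w = 2^(ρw) enter the exponents
  -- exactly. `u` makes 2^u = 2 r^w, so the increment `suc u` of `d` pays for r^s + 1 implicants and
  -- a factor 2. `d₀` is m plus the cost of the final union bound, and `ℓ` is `d w`.
  P ρ r u d₀ ℓ : ℕ
  P  = 2 ^ L
  ρ  = 22 * L
  r  = 2 ^ ρ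
  u  = suc (ρ * w)
  d₀ = m + ρ * w + w
  ℓ  = d₀ + w * suc u

  d : ℕ → ℕ
  d s = d₀ + s * suc u

  open ≤-Reasoning

  instance
    P≢0 : NonZero P
    P≢0 = m^n≢0 2 L
    r≢0 : NonZero r
    r≢0 = m^n≢0 2 ρ

  r≡P^22 : r ≡ P ^ 22
  r≡P^22 = trans (cong (2 ^_) (*-comm 22 L)) (sym (^-*-assoc 2 L 22))

  r^w : r ^ w ≡ 2 ^ (ρ * w)
  r^w = ^-*-assoc 2 ρ w

  1≤m : 1 ≤ m
  1≤m = ≤-trans (s≤s z≤n) 2≤m

  2≤P : 2 ≤ P
  2≤P = ≤-trans (*-mono-≤ 1≤w 2≤m) wm≤P

  w≤P : w ≤ P
  w≤P = ≤-trans (m≤m*n w m {{>-nonZero 1≤m}}) wm≤P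

  m≤P : m ≤ P
  m≤P = ≤-trans (m≤n*m m w {{>-nonZero 1≤w}}) wm≤P

  L≤P : L ≤ P
  L≤P = <⇒≤ (n<2^n L)

  1≤ℓ : 1 ≤ ℓ
  1≤ℓ = ≤-trans 1≤m (≤-trans (m≤m+n m (ρ * w)) (≤-trans (m≤m+n (m + ρ * w) w) (m≤m+n d₀ _)))

  P^-mono : ∀ {i j} → i ≤ j → P ^ i ≤ P ^ j
  P^-mono = ^-monoʳ-≤ P

  ℓ≤P^9 : ℓ ≤ P ^ 9
  ℓ≤P^9 = begin
    ℓ
      ≡⟨ lem₁ m w L ⟩
    m + 3 * w + 22 * (L * w) + 22 * (L * (w * w))
      ≤⟨ +-mono-≤ (+-mono-≤ (+-mono-≤ m≤P (*-monoʳ-≤ 3 w≤P)) (*-monoʳ-≤ 22 (*-mono-≤ L≤P w≤P)))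
                  (*-monoʳ-≤ 22 (*-mono-≤ L≤P (*-mono-≤ w≤P w≤P))) ⟩
    P + 3 * P + 22 * (P * P) + 22 * (P * (P * P))
      ≡⟨ lem₂ P ⟩
    4 * P ^ 1 + 22 * P ^ 2 + 22 * P ^ 3
      ≤⟨ +-monoˡ-≤ (22 * P ^ 3) (+-mono-≤ (*-monoʳ-≤ 4 (P^-mono {1} {3} (s≤s z≤n))) (*-monoʳ-≤ 22 (P^-mono {2} {3} (s≤s (s≤s z≤n))))) ⟩
    4 * P ^ 3 + 22 * P ^ 3 + 22 * P ^ 3
      ≡⟨ lem₃ (P ^ 3) ⟩
    -- 48 ≤ 64 = 2^6, and P is at least 2.
    48 * P ^ 3
      ≤⟨ *-monoˡ-≤ (P ^ 3) (≤-trans (m≤m+n 48 16) (^-monoˡ-≤ 6 2≤P)) ⟩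
    P ^ 6 * P ^ 3
      ≡⟨ ^-distribˡ-+-* P 6 3 ⟨
    P ^ 9 ∎
    where
    lem₁ : ∀ m w L → m + 22 * L * w + w + w * (1 + (1 + 22 * L * w)) ≡ m + 3 * w + 22 * (L * w) + 22 * (L * (w * w))
    lem₁ = solve-∀
    lem₂ : ∀ p → p + 3 * p + 22 * (p * p) + 22 * (p * (p * p)) ≡ 4 * (p * 1) + 22 * (p * (p * 1)) + 22 * (p * (p * (p * 1)))
    lem₂ = solve-∀
    lem₃ : ∀ p → 4 * p + 22 * p + 22 * p ≡ 48 * p
    lem₃ = solve-∀

  r-large : ℓ * 2 * (2 * ℓ * w + w) ≤ r
  r-large = begin
    ℓ * 2 * (2 * ℓ * w + w)        ≤⟨ *-monoʳ-≤ (ℓ * 2) (+-monoʳ-≤ (2 * ℓ * w) (m≤n*m w ℓ {{>-nonZero 1≤ℓ}})) ⟩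
    ℓ * 2 * (2 * ℓ * w + ℓ * w)    ≡⟨ lem ℓ w ⟩
    -- This fixes the exponent 22 of `r`: the constant costs P^3, the two factors `ℓ` cost P^18, and
    -- `w` costs P.
    6 * (ℓ * ℓ * w)                ≤⟨ *-mono-≤ (≤-trans (m≤m+n 6 2) (^-monoˡ-≤ 3 2≤P)) (*-mono-≤ (*-mono-≤ ℓ≤P^9 ℓ≤P^9) w≤P) ⟩
    P ^ 3 * (P ^ 9 * P ^ 9 * P)    ≡⟨ cong (P ^ 3 *_) (cong₂ _*_ (sym (^-distribˡ-+-* P 9 9)) (sym (^-identityʳ P))) ⟩
    P ^ 3 * (P ^ 18 * P ^ 1)       ≡⟨ cong (P ^ 3 *_) (^-distribˡ-+-* P 18 1) ⟨
    P ^ 3 * P ^ 19                 ≡⟨ ^-distribˡ-+-* P 3 19 ⟨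
    P ^ 22                         ≡⟨ r≡P^22 ⟨
    r                              ∎
    where
    lem : ∀ l w → l * 2 * (2 * l * w + l * w) ≡ 6 * (l * l * w)
    lem = solve-∀

  d<ℓ : ∀ {t} → t < w → d t < ℓ
  d<ℓ t<w = +-monoʳ-< d₀ (*-monoˡ-< (suc u) t<w)

  d-steep : ∀ {t s} → t < s → s ≤ w → 2 ^ suc (d t) * suc (r ^ s) ≤ 2 ^ d s
  d-steep {t} {s} t<s s≤w = begin
    2 ^ suc (d t) * suc (r ^ s)          ≤⟨ *-monoʳ-≤ (2 ^ suc (d t)) (s≤s (^-monoʳ-≤ r s≤w)) ⟩
    2 ^ suc (d t) * suc (r ^ w)          ≤⟨ *-monoʳ-≤ (2 ^ suc (d t)) (+-monoˡ-≤ (r ^ w) (m^n>0 r w)) ⟩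
    2 ^ suc (d t) * (r ^ w + r ^ w)      ≡⟨ cong (2 ^ suc (d t) *_) (trans (cong (r ^ w +_) (sym (+-identityʳ _))) (cong (2 *_) r^w)) ⟩
    2 ^ suc (d t) * 2 ^ u                ≡⟨ ^-distribˡ-+-* 2 (suc (d t)) u ⟨
    2 ^ (suc (d t) + u)                  ≡⟨ cong (2 ^_) (lem d₀ (t * suc u) u) ⟩
    2 ^ (d₀ + suc t * suc u)             ≤⟨ ^-monoʳ-≤ 2 (+-monoʳ-≤ d₀ (*-monoˡ-≤ (suc u) t<s)) ⟩
    2 ^ d s                              ∎
    where
    lem : ∀ a b u → 1 + (a + b) + u ≡ a + (1 + u + b)
    lem = solve-∀

  d-least : ∀ s → d 0 ≤ d s
  d-least s = +-monoʳ-≤ d₀ z≤n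

  -- The union bound loses (w + 1) r^w ≤ 2^w 2^(ρw), which is the excess of 2^d₀ over 2^m.
  error-absorbed : ∀ {E N} → 2 ^ d 0 * E ≤ suc w * r ^ w * N → 2 ^ m * E ≤ N
  error-absorbed {E} {N} le = *-cancelˡ-≤ (2 ^ w * r ^ w) {{m*n≢0 (2 ^ w) (r ^ w) {{m^n≢0 2 w}} {{m^n≢0 r w}}}} (begin
    2 ^ w * r ^ w * (2 ^ m * E)       ≡⟨ lem (2 ^ w) (r ^ w) (2 ^ m) E ⟩
    2 ^ m * r ^ w * 2 ^ w * E         ≡⟨ cong (λ x → 2 ^ m * x * 2 ^ w * E) r^w ⟩
    2 ^ m * 2 ^ (ρ * w) * 2 ^ w * E   ≡⟨ cong (_* E) (trans (cong (_* 2 ^ w) (sym (^-distribˡ-+-* 2 m (ρ * w))))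
                                           (sym (^-distribˡ-+-* 2 (m + ρ * w) w))) ⟩
    2 ^ d₀ * E                        ≡⟨ cong (λ k → 2 ^ k * E) (+-identityʳ d₀) ⟨
    2 ^ d 0 * E                       ≤⟨ le ⟩
    suc w * r ^ w * N                 ≤⟨ *-monoˡ-≤ N (*-monoˡ-≤ (r ^ w) (n<2^n w)) ⟩
    2 ^ w * r ^ w * N                 ∎)
    where
    lem : ∀ a b c e → a * b * (c * e) ≡ c * b * a * e
    lem = solve-∀

  -- Besides r^w = P^(22w) the factors are at most 2P and P, together at most P^3; as w ≥ 1 this is
  -- charged to P^(3w), whence 25.
  core-bound : suc w * r ^ w * w ≤ P ^ (25 * w)
  core-bound = begin
    suc w * r ^ w * w              ≤⟨ *-mono-≤ (*-monoˡ-≤ (r ^ w) (≤-trans (+-mono-≤ 1≤w w≤P) (+-monoˡ-≤ P w≤P))) w≤P ⟩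
    (P + P) * r ^ w * P            ≡⟨ cong (λ x → (P + P) * x * P) (trans (cong (_^ w) r≡P^22) (^-*-assoc P 22 w)) ⟩
    (P + P) * P ^ (22 * w) * P     ≡⟨ lem P (P ^ (22 * w)) ⟩
    2 * (P * (P * P ^ (22 * w)))   ≤⟨ *-monoˡ-≤ _ 2≤P ⟩
    P ^ (3 + 22 * w)               ≤⟨ P^-mono (+-monoˡ-≤ (22 * w) (*-monoʳ-≤ 3 1≤w)) ⟩
    P ^ (3 * w + 22 * w)           ≡⟨ cong (P ^_) (*-distribʳ-+ w 3 22) ⟨
    P ^ (25 * w)                   ∎
    where
    lem : ∀ p x → (p + p) * x * p ≡ 2 * (p * (p * x))
    lem = solve-∀

-- The theorem for error 2^-m. The factor 2 in the base is the loss from rounding w m up to a power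
-- of two.
junta-approximation : ∀ {w m} → 1 ≤ w → 2 ≤ m → (f : BoolFun n) (φ : DNF n) → HasWidth w φ → Computes φ f →
  ∃[ k ] ∃[ g ] IsJunta k g × k ≤ (2 * (w * m)) ^ (25 * w) ×
    2 ^ m * (∑[ x ∈ points n ] 𝟙 (¬? (f x Bool.≟ g x))) ≤ 2 ^ n
junta-approximation {n} {w} {m} 1≤w 2≤m f φ width comp
  with power-of-two-above (w * m) (*-mono-≤ 1≤w (≤-trans (s≤s z≤n) 2≤m))
... | L , lo , hi = suc w * r ^ w * w , approximator , junta ,
    ≤-trans core-bound (^-monoˡ-≤ (25 * w) hi) , error-absorbed ∑-error
  where
  open Parameters w m L 1≤w 2≤m lo
  open Implicants f d
  open Count w ℓ r 1≤w 1≤ℓ r-large d<ℓ d-steep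
  open Approximation d-least (DNF-certificate φ width comp)

-- Rational and real bounds

open import Data.Integer using (+_; -[1+_]; +≤+)

/ℚ-*-fromℕ : ∀ a d .{{_ : NonZero d}} → (+ a /ℚ d) *ℚ fromℕ d ≡ fromℕ a
/ℚ-*-fromℕ a (suc d) = ℚₚ.toℚᵘ-injective (begin
  toℚᵘ ((+ a /ℚ suc d) *ℚ fromℕ (suc d))           ≈⟨ ℚₚ.toℚᵘ-homo-* (+ a /ℚ suc d) (fromℕ (suc d)) ⟩
  toℚᵘ (+ a /ℚ suc d) ℚᵘ.* toℚᵘ (fromℕ (suc d))    ≈⟨ ℚᵘₚ.*-cong (ℚₚ.toℚᵘ-fromℚᵘ (mkℚᵘ (+ a) d)) (ℚₚ.toℚᵘ-fromℚᵘ (mkℚᵘ (+ suc d) 0)) ⟩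
  mkℚᵘ (+ a) d ℚᵘ.* mkℚᵘ (+ suc d) 0               ≈⟨ *≡* (trans (ℤₚ.*-assoc (+ a) (+ suc d) (+ 1)) (cong (+ a ℤ.*_) (sym (ℤₚ.pos-* (suc d) 1)))) ⟩
  mkℚᵘ (+ a) 0                                      ≈⟨ ℚₚ.toℚᵘ-fromℚᵘ (mkℚᵘ (+ a) 0) ⟨
  toℚᵘ (fromℕ a)                                    ∎)
  where open ℚᵘₚ.≃-Reasoning

fromℕ-* : ∀ a b → fromℕ (a * b) ≡ fromℕ a *ℚ fromℕ b
fromℕ-* a b = ℚₚ.toℚᵘ-injective (begin
  toℚᵘ (fromℕ (a * b))                    ≈⟨ ℚₚ.toℚᵘ-fromℚᵘ (mkℚᵘ (+ (a * b)) 0) ⟩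
  mkℚᵘ (+ (a * b)) 0                      ≈⟨ *≡* (cong (ℤ._* + 1) (ℤₚ.pos-* a b)) ⟩
  mkℚᵘ (+ a) 0 ℚᵘ.* mkℚᵘ (+ b) 0          ≈⟨ ℚᵘₚ.*-cong (ℚₚ.toℚᵘ-fromℚᵘ (mkℚᵘ (+ a) 0)) (ℚₚ.toℚᵘ-fromℚᵘ (mkℚᵘ (+ b) 0)) ⟨
  toℚᵘ (fromℕ a) ℚᵘ.* toℚᵘ (fromℕ b)      ≈⟨ ℚₚ.toℚᵘ-homo-* (fromℕ a) (fromℕ b) ⟨
  toℚᵘ (fromℕ a *ℚ fromℕ b)               ∎)
  where open ℚᵘₚ.≃-Reasoning

fromℕ-+ : ∀ a b → fromℕ (a + b) ≡ fromℕ a +ℚ fromℕ b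
fromℕ-+ a b = ℚₚ.toℚᵘ-injective (begin
  toℚᵘ (fromℕ (a + b))                    ≈⟨ ℚₚ.toℚᵘ-fromℚᵘ (mkℚᵘ (+ (a + b)) 0) ⟩
  mkℚᵘ (+ (a + b)) 0                      ≈⟨ *≡* (cong (ℤ._* + 1) (sym (cong₂ ℤ._+_ (ℤₚ.*-identityʳ (+ a)) (ℤₚ.*-identityʳ (+ b))))) ⟩
  mkℚᵘ (+ a) 0 ℚᵘ.+ mkℚᵘ (+ b) 0          ≈⟨ ℚᵘₚ.+-cong (ℚₚ.toℚᵘ-fromℚᵘ (mkℚᵘ (+ a) 0)) (ℚₚ.toℚᵘ-fromℚᵘ (mkℚᵘ (+ b) 0)) ⟨
  toℚᵘ (fromℕ a) ℚᵘ.+ toℚᵘ (fromℕ b)      ≈⟨ ℚₚ.toℚᵘ-homo-+ (fromℕ a) (fromℕ b) ⟨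
  toℚᵘ (fromℕ a +ℚ fromℕ b)               ∎)
  where open ℚᵘₚ.≃-Reasoning

fromℕ-^ : ∀ a k → fromℕ (a ^ k) ≡ fromℕ a ^ℚ k
fromℕ-^ a zero    = refl
fromℕ-^ a (suc k) = trans (fromℕ-* a (a ^ k)) (cong (fromℕ a *ℚ_) (fromℕ-^ a k))

fromℕ≡mkℚ : ∀ a → fromℕ a ≡ mkℚ (+ a) 0 (coprime-sym (1-coprimeTo a))
fromℕ≡mkℚ a = ℚₚ.↥p/↧p≡p (mkℚ (+ a) 0 (coprime-sym (1-coprimeTo a)))

fromℕ-≤ : ∀ a b q → ↥ q ≡ + b → a * ↧ₙ q ≤ b → fromℕ a ≤ℚ q
fromℕ-≤ a b (mkℚ _ d _) refl le rewrite fromℕ≡mkℚ a = *≤* (begin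
  + a ℤ.* + suc d   ≡⟨ ℤₚ.pos-* a (suc d) ⟨
  + (a * suc d)     ≤⟨ +≤+ le ⟩
  + b               ≡⟨ ℤₚ.*-identityʳ (+ b) ⟨
  + b ℤ.* + 1       ∎)
  where open ℤₚ.≤-Reasoning

fromℕ-mono-≤ : ∀ {a b} → a ≤ b → fromℕ a ≤ℚ fromℕ b
fromℕ-mono-≤ {a} {b} le = subst (fromℕ a ≤ℚ_) (sym (fromℕ≡mkℚ b))
  (fromℕ-≤ a b (mkℚ (+ b) 0 (coprime-sym (1-coprimeTo b))) refl (≤-trans (≤-reflexive (*-identityʳ a)) le))

0≤fromℕ : ∀ a → 0ℚ ≤ℚ fromℕ a
0≤fromℕ a = fromℕ-mono-≤ (z≤n {a})

*ℚ-mono-≤ : ∀ {p q r s} → 0ℚ ≤ℚ q → 0ℚ ≤ℚ r → p ≤ℚ q → r ≤ℚ s → p *ℚ r ≤ℚ q *ℚ s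
*ℚ-mono-≤ {p} {q} {r} {s} 0≤q 0≤r p≤q r≤s = ℚₚ.≤-trans
  (ℚₚ.*-monoʳ-≤-nonNeg r {{nonNegative 0≤r}} p≤q) (ℚₚ.*-monoˡ-≤-nonNeg q {{nonNegative 0≤q}} r≤s)

*ℚ-nonNeg : ∀ {p q} → 0ℚ ≤ℚ p → 0ℚ ≤ℚ q → 0ℚ ≤ℚ p *ℚ q
*ℚ-nonNeg {p} {q} 0≤p 0≤q = subst (_≤ℚ p *ℚ q) (ℚₚ.*-zeroˡ 0ℚ) (*ℚ-mono-≤ 0≤p ℚₚ.≤-refl 0≤p 0≤q)

^ℚ-nonNeg : ∀ {p} k → 0ℚ ≤ℚ p → 0ℚ ≤ℚ p ^ℚ k
^ℚ-nonNeg zero    0≤p = 0≤fromℕ 1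
^ℚ-nonNeg (suc k) 0≤p = *ℚ-nonNeg 0≤p (^ℚ-nonNeg k 0≤p)

^ℚ-mono-≤ : ∀ {p q} k → 0ℚ ≤ℚ p → p ≤ℚ q → p ^ℚ k ≤ℚ q ^ℚ k
^ℚ-mono-≤ zero    0≤p p≤q = ℚₚ.≤-refl
^ℚ-mono-≤ (suc k) 0≤p p≤q = *ℚ-mono-≤ (ℚₚ.≤-trans 0≤p p≤q) (^ℚ-nonNeg k 0≤p) p≤q (^ℚ-mono-≤ k 0≤p p≤q)

0≤½ : 0ℚ ≤ℚ ½
0≤½ = *≤* (+≤+ z≤n)

½<1 : ½ <ℚ 1ℚ
½<1 = *<* (ℤ.+<+ (s≤s (s≤s z≤n)))

½^ : ℕ → ℚ
½^ k = ½ ^ℚ k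

½^-nonNeg : ∀ k → 0ℚ ≤ℚ ½^ k
½^-nonNeg k = ^ℚ-nonNeg k 0≤½

½^-pos : ∀ k → 0ℚ <ℚ ½^ k
½^-pos zero    = *<* (ℤ.+<+ (s≤s z≤n))
½^-pos (suc k) = subst (_<ℚ ½^ (suc k)) (ℚₚ.*-zeroʳ ½) (ℚₚ.*-monoʳ-<-pos ½ (½^-pos k))

½^-suc-< : ∀ k → ½^ (suc k) <ℚ ½^ k
½^-suc-< k = subst (½^ (suc k) <ℚ_) (ℚₚ.*-identityˡ (½^ k)) (ℚₚ.*-monoˡ-<-pos (½^ k) {{positive (½^-pos k)}} ½<1)

½^-≤1 : ∀ k → ½^ k ≤ℚ 1ℚ
½^-≤1 zero    = ℚₚ.≤-refl
½^-≤1 (suc k) = ℚₚ.≤-trans (ℚₚ.<⇒≤ (½^-suc-< k)) (½^-≤1 k)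

½^-*-2^ : ∀ k → ½^ k *ℚ fromℕ (2 ^ k) ≡ 1ℚ
½^-*-2^ zero    = refl
½^-*-2^ (suc k) = begin
  (½ *ℚ ½^ k) *ℚ fromℕ (2 * 2 ^ k)               ≡⟨ cong ((½ *ℚ ½^ k) *ℚ_) (fromℕ-* 2 (2 ^ k)) ⟩
  (½ *ℚ ½^ k) *ℚ (fromℕ 2 *ℚ fromℕ (2 ^ k))      ≡⟨ ℚₚ.*-assoc ½ (½^ k) _ ⟩
  ½ *ℚ (½^ k *ℚ (fromℕ 2 *ℚ fromℕ (2 ^ k)))      ≡⟨ cong (½ *ℚ_) (ℚₚ.*-assoc (½^ k) (fromℕ 2) _) ⟨
  ½ *ℚ ((½^ k *ℚ fromℕ 2) *ℚ fromℕ (2 ^ k))      ≡⟨ cong (λ x → ½ *ℚ (x *ℚ fromℕ (2 ^ k))) (ℚₚ.*-comm (½^ k) (fromℕ 2)) ⟩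
  ½ *ℚ ((fromℕ 2 *ℚ ½^ k) *ℚ fromℕ (2 ^ k))      ≡⟨ cong (½ *ℚ_) (ℚₚ.*-assoc (fromℕ 2) (½^ k) _) ⟩
  ½ *ℚ (fromℕ 2 *ℚ (½^ k *ℚ fromℕ (2 ^ k)))      ≡⟨ cong (λ x → ½ *ℚ (fromℕ 2 *ℚ x)) (½^-*-2^ k) ⟩
  1ℚ                                             ∎
  where open ≡-Reasoning

/ℚ-≤-½^ : ∀ m E d .{{_ : NonZero d}} → 2 ^ m * E ≤ d → (+ E /ℚ d) ≤ℚ ½^ m
/ℚ-≤-½^ m E d@(suc _) le = ℚₚ.*-cancelʳ-≤-pos (fromℕ d) {{positive (ℚₚ.<-≤-trans (½^-pos 0) (fromℕ-mono-≤ {1} {d} (s≤s z≤n)))}} (begin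
  (+ E /ℚ d) *ℚ fromℕ d                   ≡⟨ /ℚ-*-fromℕ E d ⟩
  fromℕ E                                 ≡⟨ ℚₚ.*-identityˡ (fromℕ E) ⟨
  1ℚ *ℚ fromℕ E                           ≡⟨ cong (_*ℚ fromℕ E) (½^-*-2^ m) ⟨
  (½^ m *ℚ fromℕ (2 ^ m)) *ℚ fromℕ E      ≡⟨ ℚₚ.*-assoc (½^ m) _ _ ⟩
  ½^ m *ℚ (fromℕ (2 ^ m) *ℚ fromℕ E)      ≡⟨ cong (½^ m *ℚ_) (fromℕ-* (2 ^ m) E) ⟨
  ½^ m *ℚ fromℕ (2 ^ m * E)               ≤⟨ ℚₚ.*-monoˡ-≤-nonNeg (½^ m) {{nonNegative (½^-nonNeg m)}} (fromℕ-mono-≤ le) ⟩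
  ½^ m *ℚ fromℕ d                         ∎)
  where open ℚₚ.≤-Reasoning

-- A positive rational with denominator b is at least 1/b, hence at least 2^-b.
½^-≤-positive : ∀ r → 0ℚ <ℚ r → ½^ (↧ₙ r) ≤ℚ r
½^-≤-positive (mkℚ (+ zero) d c)  (*<* (ℤ.+<+ ()))
½^-≤-positive (mkℚ -[1+ _ ] d c) (*<* ())
½^-≤-positive r@(mkℚ (+ suc a) d c) _ = subst (½^ (suc d) ≤ℚ_) (ℚₚ.↥p/↧p≡p r)
  (ℚₚ.*-cancelʳ-≤-pos (fromℕ (suc d)) {{positive (ℚₚ.<-≤-trans (½^-pos 0) (fromℕ-mono-≤ {1} {suc d} (s≤s z≤n)))}} (begin
  ½^ (suc d) *ℚ fromℕ (suc d)           ≤⟨ ℚₚ.*-monoˡ-≤-nonNeg (½^ (suc d)) {{nonNegative (½^-nonNeg (suc d))}}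
                                             (fromℕ-mono-≤ (<⇒≤ (n<2^n (suc d)))) ⟩
  ½^ (suc d) *ℚ fromℕ (2 ^ suc d)       ≡⟨ ½^-*-2^ (suc d) ⟩
  fromℕ 1                               ≤⟨ fromℕ-mono-≤ {1} {suc a} (s≤s z≤n) ⟩
  fromℕ (suc a)                         ≡⟨ /ℚ-*-fromℕ (suc a) (suc d) ⟨
  (+ suc a /ℚ suc d) *ℚ fromℕ (suc d)   ∎))
  where open ℚₚ.≤-Reasoning

-- Dyadic scale and logarithm of a real number

module Reals (ε : ℝ) where
  open ℝ ε

  lower-≤ : ∀ {q r} → q ≤ℚ r → lower r → lower q
  lower-≤ {q} {r} q≤r lr with ℚₚ.<-cmp q r
  ... | tri< q<r _ _  = lower-closed q<r lr
  ... | tri≈ _ refl _ = lr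
  ... | tri> _ _ r<q  = contradiction (ℚₚ.<-≤-trans r<q q≤r) (ℚₚ.<-irrefl refl)

  lower-upper-≤ : ∀ {q r} → lower q → upper r → q ≤ℚ r
  lower-upper-≤ {q} {r} lq ur = ℚₚ.≮⇒≥ λ r<q → disjoint (lq , upper-closed r<q ur)

  ≤-lower⇒≤ʳ : ∀ {q r} → q ≤ℚ r → lower r → q ≤ʳ ε
  ≤-lower⇒≤ʳ q≤r lr uq = disjoint (lower-≤ q≤r lr , uq)

  -- Either alternative gives m + 2 ≤ 2 · max {2, log₂ (1 / ε)}.
  dyadic-scale : lower 0ℚ → ∃[ m ] lower (½^ (2 + m)) × (m ≡ 0 ⊎ upper (½^ m))
  dyadic-scale l0 with lower-rounded l0
  -- The descent starts at the denominator of a positive rational `r` below ε, where 2^-b ≤ r.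
  ... | r , 0<r , lr = descend (↧ₙ r) (lower-≤
    (ℚₚ.≤-trans (ℚₚ.<⇒≤ (½^-suc-< (suc (↧ₙ r)))) (ℚₚ.≤-trans (ℚₚ.<⇒≤ (½^-suc-< (↧ₙ r))) (½^-≤-positive r 0<r))) lr)
    where
    descend : ∀ m → lower (½^ (2 + m)) → ∃[ m ] lower (½^ (2 + m)) × (m ≡ 0 ⊎ upper (½^ m))
    descend zero    l = 0 , l , inj₁ refl
    -- Locatedness only chooses between two distinct rationals, here adjacent powers of ½. This is
    -- why the exponents of the lower and the upper bound end up two apart.
    descend (suc m) l with located (½^-suc-< (suc m))
    ... | inj₁ l′ = descend m l′
    ... | inj₂ u  = suc m , l , inj₂ u

  -- With q = a/b, the witness `r` is at most 2^-m. If a < mb then 2^a r^b ≤ 2^(a - mb) < 1, against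
  -- the definition of q exceeding the logarithm.
  upper-½^⇒≤ : ∀ {m q} → upper (½^ m) → fromℕ 2 <ℚ q → log₂[1/ ε ]< q → fromℕ m ≤ℚ q
  upper-½^⇒≤ {m} {mkℚ -[1+ _ ] d c} u 2<q _ = contradiction (ℚₚ.<-trans (ℚₚ.≤-<-trans (0≤fromℕ 2) 2<q) (*<* ℤ.-<+)) (ℚₚ.<-irrefl refl)
  upper-½^⇒≤ {m} {q@(mkℚ (+ a) d c)} u 2<q (r , lr , 0<r , 1≤) = fromℕ-≤ m a q refl (≮⇒≥ λ a<mb →
    ℚₚ.<-irrefl refl (ℚₚ.<-≤-trans (too-small a<mb) 1≤))
    where
    b = suc d
    too-small : a < m * b → fromℕ 2 ^ℚ a *ℚ r ^ℚ b <ℚ 1ℚ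
    too-small a<mb = ℚₚ.≤-<-trans (begin
      fromℕ 2 ^ℚ a *ℚ r ^ℚ b
        ≤⟨ ℚₚ.*-monoˡ-≤-nonNeg (fromℕ 2 ^ℚ a) {{nonNegative (^ℚ-nonNeg a (0≤fromℕ 2))}} (^ℚ-mono-≤ b (ℚₚ.<⇒≤ 0<r) (lower-upper-≤ lr u)) ⟩
      fromℕ 2 ^ℚ a *ℚ (½^ m) ^ℚ b
        ≡⟨ cong₂ _*ℚ_ (sym (fromℕ-^ 2 a)) (trans (^ℚ-assocʳ ½ m b) (cong ½^ (sym (m+[n∸m]≡n a<mb)))) ⟩
      fromℕ (2 ^ a) *ℚ ½^ (suc a + e)
        ≡⟨ cong (λ k → fromℕ (2 ^ a) *ℚ ½^ k) (sym (+-suc a e)) ⟩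
      fromℕ (2 ^ a) *ℚ ½^ (a + suc e)
        ≡⟨ cong (fromℕ (2 ^ a) *ℚ_) (^ℚ-homo-* ½ a (suc e)) ⟩
      fromℕ (2 ^ a) *ℚ (½^ a *ℚ ½^ (suc e))
        ≡⟨ ℚₚ.*-assoc (fromℕ (2 ^ a)) (½^ a) _ ⟨
      (fromℕ (2 ^ a) *ℚ ½^ a) *ℚ ½^ (suc e)
        ≡⟨ cong (_*ℚ ½^ (suc e)) (trans (ℚₚ.*-comm (fromℕ (2 ^ a)) (½^ a)) (½^-*-2^ a)) ⟩
      1ℚ *ℚ ½^ (suc e)
        ≡⟨ ℚₚ.*-identityˡ (½^ (suc e)) ⟩
      ½^ (suc e) ∎)
      (ℚₚ.<-≤-trans (½^-suc-< e) (½^-≤1 e))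
      where
      open ℚₚ.≤-Reasoning
      e = m * b ∸ suc a

-- With y = wq the base is at most 4y, and 4y ≤ y^3 because y ≥ 2. The constant is thus traded for a
-- tripled exponent, from 25w to 75w.
scale-bound : ∀ {w m k} q → 1 ≤ w → fromℕ 2 <ℚ q → fromℕ (2 + m) ≤ℚ q +ℚ q →
  k ≤ (2 * (w * (2 + m))) ^ (25 * w) → fromℕ k ≤ℚ (fromℕ w *ℚ q) ^ℚ (75 * w)
scale-bound {w} {m} {k} q 1≤w 2<q m≤2q k≤ = begin
  fromℕ k                                     ≤⟨ fromℕ-mono-≤ k≤ ⟩
  fromℕ ((2 * (w * (2 + m))) ^ (25 * w))      ≡⟨ fromℕ-^ (2 * (w * (2 + m))) (25 * w) ⟩
  fromℕ (2 * (w * (2 + m))) ^ℚ (25 * w)       ≤⟨ ^ℚ-mono-≤ (25 * w) (0≤fromℕ (2 * (w * (2 + m)))) base ⟩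
  (y ^ℚ 3) ^ℚ (25 * w)                        ≡⟨ trans (^ℚ-assocʳ y 3 (25 * w)) (cong (y ^ℚ_) (sym (*-assoc 3 25 w))) ⟩
  y ^ℚ (75 * w)                               ∎
  where
  open ℚₚ.≤-Reasoning
  y = fromℕ w *ℚ q
  0≤q : 0ℚ ≤ℚ q
  0≤q = ℚₚ.≤-trans (0≤fromℕ 2) (ℚₚ.<⇒≤ 2<q)
  2≤y : fromℕ 2 ≤ℚ y
  2≤y = subst (_≤ℚ y) (ℚₚ.*-identityˡ (fromℕ 2)) (*ℚ-mono-≤ (0≤fromℕ w) (0≤fromℕ 2) (fromℕ-mono-≤ 1≤w) (ℚₚ.<⇒≤ 2<q))
  0≤y : 0ℚ ≤ℚ y
  0≤y = *ℚ-nonNeg (0≤fromℕ w) 0≤q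
  double : ∀ z → z +ℚ z ≡ fromℕ 2 *ℚ z
  double z = sym (trans (ℚₚ.*-distribʳ-+ z 1ℚ 1ℚ) (cong₂ _+ℚ_ (ℚₚ.*-identityˡ z) (ℚₚ.*-identityˡ z)))
  base : fromℕ (2 * (w * (2 + m))) ≤ℚ y ^ℚ 3
  base = begin
    fromℕ (2 * (w * (2 + m)))
      ≡⟨ trans (fromℕ-* 2 (w * (2 + m))) (cong (fromℕ 2 *ℚ_) (fromℕ-* w (2 + m))) ⟩
    fromℕ 2 *ℚ (fromℕ w *ℚ fromℕ (2 + m))
      ≤⟨ ℚₚ.*-monoˡ-≤-nonNeg (fromℕ 2) (ℚₚ.*-monoˡ-≤-nonNeg (fromℕ w) {{nonNegative (0≤fromℕ w)}} m≤2q) ⟩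
    fromℕ 2 *ℚ (fromℕ w *ℚ (q +ℚ q))
      ≡⟨ cong (fromℕ 2 *ℚ_) (trans (ℚₚ.*-distribˡ-+ (fromℕ w) q q) (double y)) ⟩
    fromℕ 2 *ℚ (fromℕ 2 *ℚ y)
      ≤⟨ *ℚ-mono-≤ 0≤y (*ℚ-nonNeg (0≤fromℕ 2) 0≤y) 2≤y (*ℚ-mono-≤ 0≤y 0≤y 2≤y (ℚₚ.≤-reflexive (sym (ℚₚ.*-identityʳ y)))) ⟩
    y ^ℚ 3 ∎

-- From counts to probabilities and real bounds

cube≡points : ∀ n → cube n ≡ points n
cube≡points zero    = refl
cube≡points (suc n) rewrite cube≡points n = cong (map (false ∷_) (points n) ++_) (sym (++-identityʳ _))

Pr-≤ : ∀ {P : Point n → Set} (P? : ∀ x → Dec (P x)) m → 2 ^ m * (∑[ x ∈ points n ] 𝟙 (P? x)) ≤ 2 ^ n → Pr P? ≤ℚ ½^ m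
Pr-≤ {n} P? m le = /ℚ-≤-½^ m _ (2 ^ n) {{m^n≢0 2 n}} (subst (λ E → 2 ^ m * E ≤ 2 ^ n) (sym count) le)
  where
  count : length (filter P? (cube n)) ≡ (∑[ x ∈ points n ] 𝟙 (P? x))
  count = trans (cong (λ xs → length (filter P? xs)) (cube≡points n)) (length-filter≡∑ P? (points n))

approximates : ∀ ε (f g : BoolFun n) m → ℝ.lower ε (½^ m) →
  2 ^ m * (∑[ x ∈ points n ] 𝟙 (¬? (f x Bool.≟ g x))) ≤ 2 ^ n → Approximates ε g f
approximates ε f g m below error = Reals.≤-lower⇒≤ʳ ε (Pr-≤ (λ x → ¬? (f x Bool.≟ g x)) m error) below

size-bound : ∀ {w k} ε m → 1 ≤ w → m ≡ 0 ⊎ ℝ.upper ε (½^ m) → k ≤ (2 * (w * (2 + m))) ^ (25 * w) →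
  k ≤[ w ·log1/ ε ]^ (75 * w)
size-bound ε m 1≤w tight k≤ q (2<q , log<q) = scale-bound {m = m} q 1≤w 2<q
  (subst (_≤ℚ q +ℚ q) (sym (fromℕ-+ 2 m)) (ℚₚ.+-mono-≤ (ℚₚ.<⇒≤ 2<q) (m≤q tight))) k≤
  where
  m≤q : m ≡ 0 ⊎ ℝ.upper ε (½^ m) → fromℕ m ≤ℚ q
  m≤q (inj₁ refl) = ℚₚ.≤-trans (fromℕ-mono-≤ (z≤n {2})) (ℚₚ.<⇒≤ 2<q)
  m≤q (inj₂ u)    = Reals.upper-½^⇒≤ ε {m} u 2<q log<q

corollary1p2 : ∃[ C ] (0 < C ×
    (∀ (n w : ℕ) → 1 ≤ n → 1 ≤ w →
    ∀ (ε : ℝ) → 0ℚ <ʳ ε →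
    ∀ (f : BoolFun n) (φ : DNF n) → HasWidth w φ → Computes φ f →
    ∃[ k ] ∃[ g ] (IsJunta k g × k ≤[ w ·log1/ ε ]^ (C * w) × Approximates ε g f)))
-- 75 is 25 from `core-bound` times 3 from `scale-bound`. The counting bound is applied at precision
-- 2 + m, where 2^-(2+m) is below ε.
corollary1p2 = 75 , s≤s z≤n , λ n w _ 1≤w ε 0<ε f φ width comp →
  let m , below , tight = Reals.dyadic-scale ε 0<ε
      k , g , junta , k≤ , error = junta-approximation 1≤w (s≤s (s≤s z≤n)) f φ width comp
  in k , g , junta , size-bound ε m 1≤w tight k≤ , approximates ε f g (2 + m) below error
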